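{- For any constant $0<p_1<1$, there is an algorithm that detects, with probability at least $\left(1-\frac{\log n}{n}\right)^2$, both targets $t_1,t_2$ in any tree with $n$ vertices using $O(\log^2 n)$ direction queries.
   Context: All logarithms are base $2$. Graphs $G=(V,E)$ are connected, simple, undirected, with positive edge weights $w$; $d$ is the shortest-path distance, and $N(v)$ is the set of neighbors of $v$. For $u\in N(v)$, $N(v,u)=\{x\in V: d(v,x)=w(vu)+d(u,x)\}$. There are two unknown targets $t_1,t_2\in V$. Let $p_2=1-p_1$. Each direction query at a vertex $v$ independently directs to $t_1$ with probability $p_1$ and to $t_2$ with probability $p_2$; when it directs to $t_i$ it returns a neighbor $u\in N(v)$ with $t_i\in N(v,u)$ (without disclosing $i$). If $v=t_i$, this is revealed by the query with probability $p_i$. The constant in $O(\cdot)$ may depend on $p_1$. -}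

module Defs where

open import Algebra.Apartness.Bundles using (HeytingField; HeytingCommutativeRing)
open import Algebra.Bundles using (CommutativeRing)
open import Data.Fin.Base using (Fin)
open import Data.Fin.Properties using () renaming (_≟_ to _≟ᶠ_)
open import Data.List.Base using (List; []; _∷_; [_]; _++_; map; filter; foldr)
open import Data.List.Relation.Unary.Unique.Propositional using (Unique)
open import Data.Nat.Base as ℕ using (ℕ; zero; suc; NonZero; _⊔_; _^_)
import Data.Nat.Properties as ℕ
open import Data.Product.Base using (Σ; Σ-syntax; ∃-syntax; _×_; _,_; proj₁; proj₂; map₁)
open import Data.Sum.Base using (_⊎_; inj₁; inj₂)
import Algebra.Properties.Ring
import Algebra.Properties.Semiring.Mult
import Data.Vec.Functional as Vector
open import Function.Base using (_∘_)
open import Function.Bundles using (_⇔_; Equivalence)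
open import Level using (0ℓ) renaming (suc to lsuc; _⊔_ to _⊔ˡ_)
open import Relation.Binary.Construct.Closure.ReflexiveTransitive using (Star; ε; _◅_)
open import Relation.Binary.Core using (Rel)
open import Relation.Binary.Definitions using (Decidable; Symmetric; Irreflexive)
open import Relation.Binary.PropositionalEquality as ≡ using (_≡_)
open import Relation.Binary.Structures using (IsStrictPartialOrder)
open import Relation.Nullary using (¬_; yes; no; contradiction)
open import Relation.Nullary.Decidable using (_×-dec_; _⊎-dec_)
import Relation.Unary as U

-- The library has no real numbers.  Up to isomorphism they are the
-- Cauchy complete Archimedean ordered field.  The axioms are the usual
-- constructive ones (no decidability of _<_), so that constructive as
-- well as classical reals satisfy them.

record RealNumbers c ℓ₁ ℓ₂ : Set (lsuc (c ⊔ˡ ℓ₁ ⊔ˡ ℓ₂)) where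
  infix 4 _<_ _≤_

  field
    heytingField : HeytingField c ℓ₁ ℓ₂

  open HeytingField heytingField public

  field
    _<_                  : Rel Carrier ℓ₂
    isStrictPartialOrder : IsStrictPartialOrder _≈_ _<_
    #⇔<⊎>                : ∀ {x y} → x # y ⇔ (x < y ⊎ y < x)
    +-monoˡ-<            : ∀ {x y} z → x < y → x + z < y + z
    *-pos                : ∀ {x y} → 0# < x → 0# < y → 0# < x * y

  open IsStrictPartialOrder isStrictPartialOrder public
    using (<-respʳ-≈; <-respˡ-≈)
    renaming (irrefl to <-irrefl; trans to <-trans; asym to <-asym)

  _≤_ : Rel Carrier ℓ₂
  x ≤ y = ¬ (y < x)

  commutativeRing : CommutativeRing c ℓ₁
  commutativeRing = HeytingCommutativeRing.commutativeRing heytingCommutativeRing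

  open CommutativeRing commutativeRing public
    using (semiring; ring)

  fromℕ : ℕ → Carrier
  fromℕ n = Algebra.Properties.Semiring.Mult._×_ semiring n 1#

  _² : Carrier → Carrier
  x ² = x * x

  field
    archimedean : ∀ x → ∃[ n ] x < fromℕ n
    complete    : (x : ℕ → Carrier) →
                  (∀ {ε} → 0# < ε → ∃[ N ] ∀ {m n} → N ℕ.≤ m → N ℕ.≤ n →
                    x m < x n + ε) →
                  ∃[ l ] ∀ {ε} → 0# < ε → ∃[ N ] ∀ {n} → N ℕ.≤ n →
                    (x n < l + ε) × (l < x n + ε)

private
  floorLog : ∀ N → ∃[ m ] (2 ^ m ℕ.≤ suc N) × (suc N ℕ.≤ 2 ^ suc m)
  floorLog zero = 0 , ℕ.≤-refl , ℕ.s≤s ℕ.z≤n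
  floorLog (suc N) with floorLog N
  ... | m , lo , hi with suc (suc N) ℕ.≤? 2 ^ suc m
  ...   | yes p = m , ℕ.≤-trans lo (ℕ.n≤1+n _) , p
  ...   | no ¬p = suc m , ℕ.<⇒≤ (ℕ.≰⇒> ¬p)
    , ℕ.≤-trans (ℕ.s≤s hi)
        (ℕ.^-monoʳ-< 2 (ℕ.s≤s (ℕ.s≤s ℕ.z≤n)) (ℕ.n<1+n (suc m)))

  2^-cancel-≤ : ∀ {a b} → 2 ^ a ℕ.≤ 2 ^ b → a ℕ.≤ b
  2^-cancel-≤ {a} {b} p with a ℕ.≤? b
  ... | yes q = q
  ... | no ¬q = contradiction p
    (ℕ.<⇒≱ (ℕ.^-monoʳ-< 2 (ℕ.s≤s (ℕ.s≤s ℕ.z≤n)) (ℕ.≰⇒> ¬q)))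

  cross : ∀ n {a b a′ b′} → 2 ^ a ℕ.≤ n ^ b → n ^ b′ ℕ.≤ 2 ^ a′ →
          a ℕ.* b′ ℕ.≤ b ℕ.* a′
  cross n {a} {b} {a′} {b′} p q = 2^-cancel-≤ (begin
    2 ^ (a ℕ.* b′)  ≡⟨ ℕ.^-*-assoc 2 a b′ ⟨
    (2 ^ a) ^ b′    ≤⟨ ℕ.^-monoˡ-≤ b′ p ⟩
    (n ^ b) ^ b′    ≡⟨ ℕ.^-*-assoc n b b′ ⟩
    n ^ (b ℕ.* b′)  ≡⟨ ≡.cong (n ^_) (ℕ.*-comm b b′) ⟩
    n ^ (b′ ℕ.* b)  ≡⟨ ℕ.^-*-assoc n b′ b ⟨
    (n ^ b′) ^ b    ≤⟨ ℕ.^-monoˡ-≤ b q ⟩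
    (2 ^ a′) ^ b    ≡⟨ ℕ.^-*-assoc 2 a′ b ⟩
    2 ^ (a′ ℕ.* b)  ≡⟨ ≡.cong (2 ^_) (ℕ.*-comm a′ b) ⟩
    2 ^ (b ℕ.* a′)  ∎)
    where open ℕ.≤-Reasoning

  positive-floorLog : ∀ N .{{_ : NonZero N}} → ∃[ m ] (2 ^ m ℕ.≤ N) × (N ℕ.≤ 2 ^ suc m)
  positive-floorLog (suc N) = floorLog N

module RealProperties {c ℓ₁ ℓ₂} (R : RealNumbers c ℓ₁ ℓ₂) where
  open RealNumbers R hiding (zero)
  open Algebra.Properties.Ring ring
    using (-‿distribˡ-*; -‿distribʳ-*; -‿involutive; -0#≈0#)
  open Algebra.Properties.Semiring.Mult semiring
    using (×-homo-+; ×1-homo-*)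
  open import Relation.Binary.Reasoning.Setoid setoid

  <-cotrans : ∀ {x y} → x < y → ∀ z → x < z ⊎ z < y
  <-cotrans x<y z with #-cotrans (Equivalence.from #⇔<⊎> (inj₁ x<y)) z
  ... | inj₁ x#z with Equivalence.to #⇔<⊎> x#z
  ...   | inj₁ x<z = inj₁ x<z
  ...   | inj₂ z<x = inj₂ (<-trans z<x x<y)
  <-cotrans x<y z | inj₂ z#y with Equivalence.to #⇔<⊎> z#y
  ...   | inj₁ z<y = inj₂ z<y
  ...   | inj₂ y<z = inj₁ (<-trans x<y y<z)

  ≤-<-trans : ∀ {x y z} → x ≤ y → y < z → x < z
  ≤-<-trans {x} x≤y y<z with <-cotrans y<z x
  ... | inj₁ y<x = contradiction y<x x≤y
  ... | inj₂ x<z = x<z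

  <-≤-trans : ∀ {x y z} → x < y → y ≤ z → x < z
  <-≤-trans {z = z} x<y y≤z with <-cotrans x<y z
  ... | inj₁ x<z = x<z
  ... | inj₂ z<y = contradiction z<y y≤z

  +-monoʳ-< : ∀ {x y} z → x < y → z + x < z + y
  +-monoʳ-< z x<y = <-respʳ-≈ (+-comm _ _) (<-respˡ-≈ (+-comm _ _) (+-monoˡ-< z x<y))

  +-mono-< : ∀ {x y u v} → x < y → u < v → x + u < y + v
  +-mono-< x<y u<v = <-trans (+-monoˡ-< _ x<y) (+-monoʳ-< _ u<v)

  x<y⇒0<y-x : ∀ {x y} → x < y → 0# < y - x
  x<y⇒0<y-x {x} x<y = <-respˡ-≈ (-‿inverseʳ x) (+-monoˡ-< (- x) x<y)

  x-y+y≈x : ∀ x y → (x - y) + y ≈ x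
  x-y+y≈x x y = trans (+-assoc x (- y) y) (trans (+-congˡ (-‿inverseˡ y)) (+-identityʳ x))

  0<y-x⇒x<y : ∀ {x y} → 0# < y - x → x < y
  0<y-x⇒x<y {x} {y} 0<y-x =
    <-respʳ-≈ (x-y+y≈x y x) (<-respˡ-≈ (+-identityˡ x) (+-monoˡ-< x 0<y-x))

  *-monoˡ-< : ∀ {x y z} → 0# < z → x < y → z * x < z * y
  *-monoˡ-< {x} {y} {z} 0<z x<y = 0<y-x⇒x<y (<-respʳ-≈ eq (*-pos 0<z (x<y⇒0<y-x x<y)))
    where
    eq : z * (y - x) ≈ z * y - z * x
    eq = trans (distribˡ z y (- x)) (+-congˡ (sym (-‿distribʳ-* z x)))

  x<0⇒0<-x : ∀ {x} → x < 0# → 0# < - x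
  x<0⇒0<-x {x} x<0 = <-respʳ-≈ (+-identityˡ (- x)) (x<y⇒0<y-x x<0)

  x-0≈x : ∀ x → x - 0# ≈ x
  x-0≈x x = trans (+-congˡ -0#≈0#) (+-identityʳ x)

  0<1 : 0# < 1#
  0<1 with Equivalence.to #⇔<⊎> 1#0
    where
    1#0 : 1# # 0#
    1#0 = invertible⇒# (1# , trans (*-identityˡ _) (x-0≈x 1#) , trans (*-identityʳ _) (x-0≈x 1#))
  ... | inj₂ 0<1 = 0<1
  ... | inj₁ 1<0 = <-respʳ-≈ eq (*-pos (x<0⇒0<-x 1<0) (x<0⇒0<-x 1<0))
    where
    eq : - 1# * - 1# ≈ 1#
    eq = begin
      - 1# * - 1#     ≈⟨ -‿distribˡ-* 1# (- 1#) ⟨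
      - (1# * - 1#)   ≈⟨ -‿cong (*-identityˡ (- 1#)) ⟩
      - (- 1#)        ≈⟨ -‿involutive 1# ⟩
      1#              ∎

  0<fromℕ : ∀ n .{{_ : NonZero n}} → 0# < fromℕ n
  0<fromℕ 1             = <-respʳ-≈ (sym (+-identityʳ 1#)) 0<1
  0<fromℕ (suc (suc n)) =
    <-respˡ-≈ (+-identityʳ 0#) (+-mono-< 0<1 (0<fromℕ (suc n)))

  abstract
    inverse : ∀ {x} → 0# < x → ∃[ y ] (0# < y) × (x * y ≈ 1#)
    inverse {x} 0<x with #⇒invertible (Equivalence.from #⇔<⊎> (inj₂ 0<x))
    ... | y , yx , xy = y , 0<y , xy≈1
      where
      xy≈1 : x * y ≈ 1#
      xy≈1 = trans (*-congʳ (sym (x-0≈x x))) xy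
      y#0 : y # 0#
      y#0 = invertible⇒# (x , trans (*-congˡ (x-0≈x y)) xy≈1
                            , trans (*-congʳ (x-0≈x y)) (trans (*-comm y x) xy≈1))
      0<y : 0# < y
      0<y with Equivalence.to #⇔<⊎> y#0
      ... | inj₂ 0<y = 0<y
      ... | inj₁ y<0 = contradiction
        (<-respˡ-≈ xy≈1 (<-respʳ-≈ (zeroʳ x) (*-monoˡ-< 0<x y<0)))
        (<-asym 0<1)

  infix 9 1/_

  1/_ : ∀ n .{{_ : NonZero n}} → Carrier
  1/ n = proj₁ (inverse (0<fromℕ n))

  0<1/n : ∀ n .{{_ : NonZero n}} → 0# < 1/ n
  0<1/n n = proj₁ (proj₂ (inverse (0<fromℕ n)))

  n*1/n≈1 : ∀ n .{{_ : NonZero n}} → fromℕ n * 1/ n ≈ 1#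
  n*1/n≈1 n = proj₂ (proj₂ (inverse (0<fromℕ n)))

  -- x is log₂ n: it lies in the Dedekind cut of the fractions a / b,
  -- where a / b ≤ log₂ n means 2 ^ a ≤ n ^ b.
  IsLog₂ : ℕ → Carrier → Set ℓ₂
  IsLog₂ n x = ∀ a b →
    (2 ^ a ℕ.≤ n ^ b → fromℕ a ≤ fromℕ b * x) ×
    (n ^ b ℕ.≤ 2 ^ a → fromℕ b * x ≤ fromℕ a)

  0≤fromℕ : ∀ n → 0# ≤ fromℕ n
  0≤fromℕ zero    = <-irrefl refl
  0≤fromℕ (suc n) = <-asym (0<fromℕ (suc n))

  fromℕ-mono : ∀ {m n} → m ℕ.≤ n → fromℕ m ≤ fromℕ n
  fromℕ-mono {m} {n} m≤n n<m = 0≤fromℕ (n ℕ.∸ m)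
    (<-respˡ-≈ lhs (<-respʳ-≈ (-‿inverseˡ (fromℕ m)) (+-monoʳ-< (- fromℕ m) n<m)))
    where
    lhs : - fromℕ m + fromℕ n ≈ fromℕ (n ℕ.∸ m)
    lhs = begin
      - fromℕ m + fromℕ n
        ≡⟨ ≡.cong (λ k → - fromℕ m + fromℕ k) (ℕ.m+[n∸m]≡n m≤n) ⟨
      - fromℕ m + fromℕ (m ℕ.+ (n ℕ.∸ m))
        ≈⟨ +-congˡ (×-homo-+ 1# m (n ℕ.∸ m)) ⟩
      - fromℕ m + (fromℕ m + fromℕ (n ℕ.∸ m))
        ≈⟨ +-assoc _ _ _ ⟨
      (- fromℕ m + fromℕ m) + fromℕ (n ℕ.∸ m)
        ≈⟨ +-congʳ (-‿inverseˡ (fromℕ m)) ⟩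
      0# + fromℕ (n ℕ.∸ m)
        ≈⟨ +-identityˡ _ ⟩
      fromℕ (n ℕ.∸ m) ∎

  private
    module Log (n : ℕ) .{{_ : NonZero n}} where

      floor : ∀ k → ∃[ m ] (2 ^ m ℕ.≤ n ^ suc k) × (n ^ suc k ℕ.≤ 2 ^ suc m)
      floor k = positive-floorLog (n ^ suc k) {{ℕ.m^n≢0 n (suc k)}}

      m : ℕ → ℕ
      m k = proj₁ (floor k)

      x : ℕ → Carrier
      x k = fromℕ (m k) * 1/ suc k

      cancel : ∀ k b c → fromℕ (suc k) * (b * (c * 1/ suc k)) ≈ b * c
      cancel k b c = begin
        fromℕ (suc k) * (b * (c * 1/ suc k))    ≈⟨ *-congˡ (*-assoc b c _) ⟨
        fromℕ (suc k) * ((b * c) * 1/ suc k)    ≈⟨ *-comm _ _ ⟩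
        ((b * c) * 1/ suc k) * fromℕ (suc k)    ≈⟨ *-assoc _ _ _ ⟩
        (b * c) * (1/ suc k * fromℕ (suc k))    ≈⟨ *-congˡ (*-comm _ _) ⟩
        (b * c) * (fromℕ (suc k) * 1/ suc k)    ≈⟨ *-congˡ (n*1/n≈1 (suc k)) ⟩
        (b * c) * 1#                            ≈⟨ *-identityʳ _ ⟩
        b * c                                   ∎

      unscale : ∀ k c → fromℕ (suc k) * (c * 1/ suc k) ≈ c
      unscale k c = begin
        fromℕ (suc k) * (c * 1/ suc k)          ≈⟨ *-congˡ (*-identityˡ _) ⟨
        fromℕ (suc k) * (1# * (c * 1/ suc k))   ≈⟨ cancel k 1# c ⟩
        1# * c                                  ≈⟨ *-identityˡ c ⟩
        c                                       ∎

      x+1/k : ∀ k → x k + 1/ suc k ≈ fromℕ (suc (m k)) * 1/ suc k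
      x+1/k k = begin
        x k + 1/ suc k          ≈⟨ +-comm _ _ ⟩
        1/ suc k + x k          ≈⟨ +-congʳ (*-identityˡ _) ⟨
        1# * 1/ suc k + x k     ≈⟨ distribʳ _ _ _ ⟨
        fromℕ (suc (m k)) * 1/ suc k  ∎

      upper : ∀ a b → 2 ^ a ℕ.≤ n ^ b → ∀ k → fromℕ a ≤ fromℕ b * (x k + 1/ suc k)
      upper a b p k lt =
        fromℕ-mono (ℕ.≤-trans (ℕ.≤-reflexive (ℕ.*-comm (suc k) a))
                              (cross n {a} {b} {suc (m k)} {suc k} p (proj₂ (proj₂ (floor k)))))
          (<-respˡ-≈ lhs (<-respʳ-≈ (sym (×1-homo-* (suc k) a))
            (*-monoˡ-< (0<fromℕ (suc k)) lt)))
        where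
        lhs : fromℕ (suc k) * (fromℕ b * (x k + 1/ suc k)) ≈ fromℕ (b ℕ.* suc (m k))
        lhs = trans (*-congˡ (*-congˡ (x+1/k k)))
                (trans (cancel k _ _) (sym (×1-homo-* b (suc (m k)))))

      lower : ∀ a b → n ^ b ℕ.≤ 2 ^ a → ∀ k → fromℕ b * x k ≤ fromℕ a
      lower a b p k lt =
        fromℕ-mono (ℕ.≤-trans (ℕ.≤-reflexive (ℕ.*-comm b (m k)))
                              (cross n {m k} {suc k} {a} {b} (proj₁ (proj₂ (floor k))) p))
          (<-respˡ-≈ (sym (×1-homo-* (suc k) a)) (<-respʳ-≈ rhs
            (*-monoˡ-< (0<fromℕ (suc k)) lt)))
        where
        rhs : fromℕ (suc k) * (fromℕ b * x k) ≈ fromℕ (b ℕ.* proj₁ (floor k))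
        rhs = trans (cancel k _ _) (sym (×1-homo-* b (m k)))

      vanishing : ∀ {δ} → 0# < δ → ∃[ N ] ∀ {k} → N ℕ.≤ k → 1/ suc k < δ
      vanishing {δ} 0<δ with inverse 0<δ
      ... | y , 0<y , δy≈1 with archimedean y
      ...   | N , y<N = N , bound
        where
        bound : ∀ {k} → N ℕ.≤ k → 1/ suc k < δ
        bound {k} N≤k = <-respˡ-≈ lhs (<-respʳ-≈ rhs (*-monoˡ-< (*-pos 0<δ (0<1/n (suc k)))
          (<-≤-trans y<N (fromℕ-mono (ℕ.m≤n⇒m≤1+n N≤k)))))
          where
          lhs : (δ * 1/ suc k) * y ≈ 1/ suc k
          lhs = begin
            (δ * 1/ suc k) * y  ≈⟨ *-congʳ (*-comm _ _) ⟩
            (1/ suc k * δ) * y  ≈⟨ *-assoc _ _ _ ⟩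
            1/ suc k * (δ * y)  ≈⟨ *-congˡ δy≈1 ⟩
            1/ suc k * 1#       ≈⟨ *-identityʳ _ ⟩
            1/ suc k            ∎
          rhs : (δ * 1/ suc k) * fromℕ (suc k) ≈ δ
          rhs = trans (*-comm _ _) (unscale k δ)

      close : ∀ j k → x j ≤ x k + 1/ suc k
      close j k lt = upper (m j) (suc j) (proj₁ (proj₂ (floor j))) k
        (<-respʳ-≈ (unscale j _) (*-monoˡ-< (0<fromℕ (suc j)) lt))

      limit : ∃[ l ] ∀ {δ} → 0# < δ → ∃[ N ] ∀ {k} → N ℕ.≤ k → (x k < l + δ) × (l < x k + δ)
      limit = complete x cauchy
        where
        cauchy : ∀ {δ} → 0# < δ → ∃[ N ] ∀ {j k} → N ℕ.≤ j → N ℕ.≤ k → x j < x k + δ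
        cauchy 0<δ with vanishing 0<δ
        ... | N , small = N , λ {j} {k} _ N≤k → ≤-<-trans (close j k) (+-monoʳ-< (x k) (small N≤k))

      l : Carrier
      l = proj₁ limit

      l+[r-l]≈r : ∀ r l → l + (r - l) ≈ r
      l+[r-l]≈r r l = trans (+-comm _ _) (x-y+y≈x r l)

      half+half : ∀ δ → δ * 1/ 2 + δ * 1/ 2 ≈ δ
      half+half δ = begin
        δ * 1/ 2 + δ * 1/ 2            ≈⟨ +-congˡ (+-identityʳ _) ⟨
        δ * 1/ 2 + (δ * 1/ 2 + 0#)     ≈⟨ +-cong (*-identityˡ _) (+-cong (*-identityˡ _) (zeroˡ (δ * 1/ 2))) ⟨
        1# * (δ * 1/ 2) + (1# * (δ * 1/ 2) + 0# * (δ * 1/ 2))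
                                       ≈⟨ +-congˡ (distribʳ _ _ _) ⟨
        1# * (δ * 1/ 2) + (1# + 0#) * (δ * 1/ 2)
                                       ≈⟨ distribʳ _ _ _ ⟨
        fromℕ 2 * (δ * 1/ 2)           ≈⟨ unscale 1 δ ⟩
        δ                              ∎

      divide : ∀ b {y z} → fromℕ (suc b) * y < z → y < z * 1/ suc b
      divide b {y} {z} lt = <-respˡ-≈ lhs (<-respʳ-≈ (*-comm _ _) (*-monoˡ-< (0<1/n (suc b)) lt))
        where
        lhs : 1/ suc b * (fromℕ (suc b) * y) ≈ y
        lhs = trans (sym (*-assoc _ _ _)) (trans (*-congʳ (trans (*-comm _ _) (n*1/n≈1 (suc b)))) (*-identityˡ y))

      divide′ : ∀ b {y z} → z < fromℕ (suc b) * y → z * 1/ suc b < y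
      divide′ b {y} {z} lt = <-respʳ-≈ rhs (<-respˡ-≈ (*-comm _ _) (*-monoˡ-< (0<1/n (suc b)) lt))
        where
        rhs : 1/ suc b * (fromℕ (suc b) * y) ≈ y
        rhs = trans (sym (*-assoc _ _ _)) (trans (*-congʳ (trans (*-comm _ _) (n*1/n≈1 (suc b)))) (*-identityˡ y))

      l-upper : ∀ a b → 2 ^ a ℕ.≤ n ^ b → fromℕ a ≤ fromℕ b * l
      l-upper a zero    p lt = upper a zero p 0 (<-respˡ-≈ (trans (zeroˡ _) (sym (zeroˡ _))) lt)
      l-upper a (suc b) p lt = upper a (suc b) p k
        (<-respʳ-≈ (unscale b (fromℕ a)) (*-monoˡ-< (0<fromℕ (suc b)) x+1/k<r))
        where
        r δ : Carrier
        r = fromℕ a * 1/ suc b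
        δ = (r - l) * 1/ 2
        0<δ : 0# < δ
        0<δ = *-pos (x<y⇒0<y-x (divide b lt)) (0<1/n 2)
        k : ℕ
        k = proj₁ (proj₂ limit 0<δ) ⊔ proj₁ (vanishing 0<δ)
        x+1/k<r : x k + 1/ suc k < r
        x+1/k<r = <-respʳ-≈
          (trans (+-assoc _ _ _) (trans (+-congˡ (half+half (r - l))) (l+[r-l]≈r r l)))
          (+-mono-< (proj₁ (proj₂ (proj₂ limit 0<δ) (ℕ.m≤m⊔n (proj₁ (proj₂ limit 0<δ)) (proj₁ (vanishing 0<δ)))))
                    (proj₂ (vanishing 0<δ) (ℕ.m≤n⊔m (proj₁ (proj₂ limit 0<δ)) (proj₁ (vanishing 0<δ)))))

      l-lower : ∀ a b → n ^ b ℕ.≤ 2 ^ a → fromℕ b * l ≤ fromℕ a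
      l-lower a zero    p lt = lower a zero p 0 (<-respʳ-≈ (trans (zeroˡ _) (sym (zeroˡ _))) lt)
      l-lower a (suc b) p lt = lower a (suc b) p k
        (<-respˡ-≈ (unscale b (fromℕ a)) (*-monoˡ-< (0<fromℕ (suc b)) r<x))
        where
        r : Carrier
        r = fromℕ a * 1/ suc b
        0<l-r : 0# < l - r
        0<l-r = x<y⇒0<y-x (divide′ b lt)
        k : ℕ
        k = proj₁ (proj₂ limit 0<l-r)
        r<x : r < x k
        r<x = 0<y-x⇒x<y (<-respʳ-≈ eq
          (x<y⇒0<y-x (proj₂ (proj₂ (proj₂ limit 0<l-r) ℕ.≤-refl))))
          where
          eq : (x k + (l - r)) - l ≈ x k - r
          eq = begin
            (x k + (l - r)) - l       ≈⟨ +-assoc _ _ _ ⟩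
            x k + ((l - r) - l)       ≈⟨ +-congˡ (+-congʳ (+-comm _ _)) ⟩
            x k + ((- r + l) - l)     ≈⟨ +-congˡ (+-assoc _ _ _) ⟩
            x k + (- r + (l - l))     ≈⟨ +-congˡ (+-congˡ (-‿inverseʳ l)) ⟩
            x k + (- r + 0#)          ≈⟨ +-congˡ (+-identityʳ _) ⟩
            x k - r                   ∎

  abstract
    log₂-exists : ∀ n .{{_ : NonZero n}} → ∃[ x ] IsLog₂ n x
    log₂-exists n = Log.l n , λ a b → Log.l-upper n a b , Log.l-lower n a b

  log₂ : ∀ n .{{_ : NonZero n}} → Carrier
  log₂ n = proj₁ (log₂-exists n)

module _ {c ℓ₁ ℓ₂} (R : RealNumbers c ℓ₁ ℓ₂) where
  open RealNumbers R

  record WeightedGraph (n : ℕ) : Set (lsuc 0ℓ ⊔ˡ c ⊔ˡ ℓ₁ ⊔ˡ ℓ₂) where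
    field
      Adj        : Rel (Fin n) 0ℓ
      adj?       : Decidable Adj
      adj-sym    : Symmetric Adj
      adj-irrefl : Irreflexive _≡_ Adj
      -- only the values of w on edges matter
      w          : Fin n → Fin n → Carrier
      w-sym      : ∀ {u v} → Adj u v → w u v ≈ w v u
      w-positive : ∀ {u v} → Adj u v → 0# < w u v

    Walk : Rel (Fin n) 0ℓ
    Walk = Star Adj

    length : ∀ {u v} → Walk u v → ℕ
    length ε       = 0
    length (_ ◅ p) = suc (length p)

    vertices : ∀ {u v} → Walk u v → List (Fin n)
    vertices {u} ε       = [ u ]
    vertices {u} (_ ◅ p) = u ∷ vertices p

    weight : ∀ {u v} → Walk u v → Carrier
    weight         ε             = 0#
    weight {u = u} (_◅_ {j = v} _ p) = w u v + weight p

    Connected : Set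
    Connected = ∀ u v → Walk u v

    -- a path u , … , v on at least three vertices, closed by the edge v u
    Cycle : Set
    Cycle = ∃[ u ] ∃[ v ] Σ[ p ∈ Walk u v ]
      Unique (vertices p) × 2 ℕ.≤ length p × Adj v u

    IsTree : Set
    IsTree = Connected × ¬ Cycle

    -- r is the shortest-path distance d(u,v)
    IsDistance : Fin n → Fin n → Carrier → Set (ℓ₁ ⊔ˡ ℓ₂)
    IsDistance u v r =
      (Σ[ p ∈ Walk u v ] weight p ≈ r) × (∀ (p : Walk u v) → r ≤ weight p)

    -- x ∈ N(v,u), for a neighbour u of v
    _∈N[_,_] : Fin n → Fin n → Fin n → Set (c ⊔ˡ ℓ₁ ⊔ˡ ℓ₂)
    x ∈N[ v , u ] = ∃[ r ] ∃[ s ]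
      IsDistance v x r × IsDistance u x s × r ≈ w v u + s

data Target : Set where
  first second : Target

data Reply (n : ℕ) : Set where
  found  : Reply n
  toward : Fin n → Reply n

data Strategy (n : ℕ) : Set where
  output : Fin n × Fin n → Strategy n
  query  : Fin n → (Reply n → Strategy n) → Strategy n

-- the maximum over all sequences of replies
queries : ∀ {n} → Strategy n → ℕ
queries (output _)     = 0
queries (query v next) =
  suc (queries (next found) ⊔ Vector.foldr _⊔_ 0 (λ u → queries (next (toward u))))

DetectsBoth : ∀ {n} → (Target → Fin n) → U.Pred (Fin n × Fin n) 0ℓ
DetectsBoth t (x , y) =
  (x ≡ t first × y ≡ t second) ⊎ (x ≡ t second × y ≡ t first)

detectsBoth? : ∀ {n} (t : Target → Fin n) → U.Decidable (DetectsBoth t)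
detectsBoth? t (x , y) =
  ((x ≟ᶠ t first) ×-dec (y ≟ᶠ t second)) ⊎-dec ((x ≟ᶠ t second) ×-dec (y ≟ᶠ t first))

module _ {c ℓ₁ ℓ₂} (R : RealNumbers c ℓ₁ ℓ₂) where
  open RealNumbers R

  module _ {n} (G : WeightedGraph R n) where
    open WeightedGraph G

    -- the correct replies to a query at v that directs to the target t
    data Directs (v t : Fin n) : Reply n → Set (c ⊔ˡ ℓ₁ ⊔ˡ ℓ₂) where
      found  : v ≡ t → Directs v t found
      toward : ∀ {u} → Adj v u → t ∈N[ v , u ] → Directs v t (toward u)

    -- A reply may be chosen adversarially among the correct ones, knowing
    -- the targets to which the earlier queries directed (latest first).
    record Responder (t : Target → Fin n) : Set (c ⊔ˡ ℓ₁ ⊔ˡ ℓ₂) where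
      field
        reply   : List Target → Fin n → Target → Reply n
        correct : ∀ history v i → Directs v (t i) (reply history v i)

  -- finite distributions, as lists of outcomes with their probabilities
  Distribution : Set → Set c
  Distribution A = List (Carrier × A)

  Pr : ∀ {A : Set} {P : U.Pred A 0ℓ} → U.Decidable P → Distribution A → Carrier
  Pr P? = foldr _+_ 0# ∘ map proj₁ ∘ filter (P? ∘ proj₂)

  -- The distribution of the output when each query independently directs
  -- to the first target with probability p₁ and otherwise to the second.
  runAfter : ∀ {n} {G : WeightedGraph R n} {t} → List Target → Carrier →
             Responder G t → Strategy n → Distribution (Fin n × Fin n)
  runAfter history p₁ responder (output z)     = [ 1# , z ]
  runAfter history p₁ responder (query v next) =
    map (map₁ (p₁ *_))
      (runAfter (first ∷ history) p₁ responder (next (reply history v first))) ++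
    map (map₁ ((1# - p₁) *_))
      (runAfter (second ∷ history) p₁ responder (next (reply history v second)))
    where open Responder responder

  run : ∀ {n} {G : WeightedGraph R n} {t} → Carrier → Responder G t →
        Strategy n → Distribution (Fin n × Fin n)
  run = runAfter []

  Algorithm : Set (lsuc 0ℓ ⊔ˡ c ⊔ˡ ℓ₁ ⊔ˡ ℓ₂)
  Algorithm = ∀ n .{{_ : NonZero n}} (G : WeightedGraph R n) →
              WeightedGraph.IsTree G → Strategy n

module Submission where

-- Write hop v x for the neighbour of v on the path to x, with hop v v = v.
-- In a tree N(v,u) is the component of u after removal of v, whatever the
-- weights are, so a query at v that directs to t reveals exactly hop v t
-- (direction-correct).
--
-- Suppose first that asking about v revealed hop v t for both targets t, as
-- an unordered pair.  Keep a list B of candidates for both targets, and ask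
-- about its median v, a vertex whose distances to the members of B have the
-- least sum.  Each component of the tree without v contains at most half of
-- B, since otherwise a step into it would lessen the sum (median-halves).
-- As long as both targets lie in one component, the search continues there
-- with at most half of the candidates.  Once they are separated at some v,
-- asking about any vertex x tells which answer belongs to which target: x is
-- separated at v from one of the two, and the first step from x to that
-- target is the step towards v (hop-separated), so that answer is known and
-- the other one belongs to the other target (resolve-correct).  From then on
-- the targets can be located one after the other by halving.  If
-- 2 ^ m ≤ n < 2 ^ (m + 1), then 2 m answers suffice (locateBoth-solves).
--
-- To obtain an answer about v from actual queries, query v repeatedly, at
-- most 1 + j times, until two different replies have come.  The answer is
-- wrong only if the targets are separated at v and the j queries after the
-- first one all direct to the same target as the first, which has
-- probability at most e if p₁ ^ j ≤ e and p₂ ^ j ≤ e (again-apart).  Hence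
-- the whole search fails with probability at most 2 m e (compile-success).
-- Some constant k has 2 p₁ ^ k ≤ 1 and 2 p₂ ^ k ≤ 1, by Bernoulli's
-- inequality, so j = k (2 + m) allows for e = 1 / (2 n).  Then
-- 2 m e ≤ log n / n, and with x = log n / n ≤ 1 the claim follows from
-- (1 - x) ² ≤ 1 - x.  The number of queries is at most
-- 2 m (1 + j) ≤ (6 k + 2) m ², and m ≤ log n.

open import Algebra.Bundles using (CommutativeRing)
import Algebra.Solver.Ring.NaturalCoefficients.Default as SemiringSolver
open import Data.Bool.Base using (if_then_else_; true; false)
open import Data.Fin.Base using (Fin; zero; suc)
open import Data.Fin.Properties using (_≟_)
open import Data.List.Base using (List; []; _∷_; _++_; filter; map; allFin)
import Data.List.Base as List
open import Data.List.Extrema.Nat using (argmin; f[argmin]≤f[xs])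
import Data.List.Membership.DecPropositional as DecMembership
open import Data.List.Membership.Propositional using (_∈_; _∉_)
open import Data.List.Membership.Propositional.Properties using (∈-allFin; ∈-filter⁺)
open import Data.List.Properties using (length-tabulate)
open import Data.List.Relation.Binary.Subset.Propositional using (_⊆_)
open import Data.List.Relation.Binary.Subset.Propositional.Properties using (∷⁺ʳ)
import Data.List.Relation.Unary.All as All
open import Data.List.Relation.Unary.All.Properties using (¬Any⇒All¬; All¬⇒¬Any)
import Data.List.Relation.Unary.AllPairs as AllPairs
open import Data.List.Relation.Unary.Any using (here; there)
open import Data.List.Relation.Unary.Unique.Propositional using (Unique)
open import Data.Nat.Base as ℕ using (ℕ; zero; suc; NonZero; z≤n; s≤s)
open import Data.Nat.ListAction using (sum)
import Data.Nat.Properties as ℕ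
open import Data.Nat.Tactic.RingSolver using (solve-∀)
open import Data.Product.Base using (Σ-syntax; ∃-syntax; _×_; _,_; proj₁; proj₂; map₁)
open import Data.Sum.Base using (inj₁; inj₂)
import Data.Vec.Functional as Vector
open import Defs
open import Function.Base using (_∘_; id)
open import Function.Bundles using (Equivalence)
open import Level using (0ℓ)
open import Relation.Binary.Bundles using (Preorder)
open import Relation.Binary.Construct.Closure.ReflexiveTransitive
  using (Star; ε; _◅_; _◅◅_; reverse)
open import Relation.Binary.PropositionalEquality as ≡ using (_≡_; _≢_)
open import Relation.Nullary using (yes; no; does; contradiction)
import Relation.Unary as U

-- Order of the real numbers

-- Laws of the relation x ≤ y, which stands for the negation of y < x.
module Order {c ℓ₁ ℓ₂} (R : RealNumbers c ℓ₁ ℓ₂) where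
  open RealNumbers R hiding (zero)
  open RealProperties R
  open import Algebra.Properties.Ring ring using (-‿distribʳ-*)

  <⇒≤ : ∀ {x y} → x < y → x ≤ y
  <⇒≤ = <-asym

  ≤-reflexive : ∀ {x y} → x ≈ y → x ≤ y
  ≤-reflexive x≈y = <-irrefl (sym x≈y)

  ≤-refl : ∀ {x} → x ≤ x
  ≤-refl = ≤-reflexive refl

  ≤-trans : ∀ {x y z} → x ≤ y → y ≤ z → x ≤ z
  ≤-trans x≤y y≤z z<x = x≤y (≤-<-trans y≤z z<x)

  ≤-preorder : Preorder c ℓ₁ ℓ₂
  ≤-preorder = record
    { Carrier = Carrier
    ; _≈_ = _≈_
    ; _≲_ = _≤_
    ; isPreorder = record
      { isEquivalence = isEquivalence
      ; reflexive     = ≤-reflexive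
      ; trans         = ≤-trans
      }
    }

  open import Relation.Binary.Reasoning.Preorder ≤-preorder public

  +-cancelˡ-< : ∀ z {x y} → z + x < z + y → x < y
  +-cancelˡ-< z z+x<z+y =
    <-respʳ-≈ (cancel _) (<-respˡ-≈ (cancel _) (+-monoʳ-< (- z) z+x<z+y))
    where
    cancel : ∀ x → - z + (z + x) ≈ x
    cancel x = trans (sym (+-assoc _ _ _))
      (trans (+-congʳ (-‿inverseˡ z)) (+-identityˡ x))

  +-cancelʳ-< : ∀ z {x y} → x + z < y + z → x < y
  +-cancelʳ-< z x+z<y+z =
    +-cancelˡ-< z (<-respʳ-≈ (+-comm _ _) (<-respˡ-≈ (+-comm _ _) x+z<y+z))

  +-cancelʳ-≤ : ∀ z {x y} → x + z ≤ y + z → x ≤ y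
  +-cancelʳ-≤ z x+z≤y+z y<x = x+z≤y+z (+-monoˡ-< z y<x)

  +-mono-≤ : ∀ {x y u v} → x ≤ y → u ≤ v → x + u ≤ y + v
  +-mono-≤ {y = y} {u} x≤y u≤v y+v<x+u with <-cotrans y+v<x+u (y + u)
  ... | inj₁ y+v<y+u = u≤v (+-cancelˡ-< y y+v<y+u)
  ... | inj₂ y+u<x+u = x≤y (+-cancelʳ-< u y+u<x+u)

  +-monoʳ-≤ : ∀ z {x y} → x ≤ y → z + x ≤ z + y
  +-monoʳ-≤ z = +-mono-≤ ≤-refl

  +-monoˡ-≤ : ∀ z {x y} → x ≤ y → x + z ≤ y + z
  +-monoˡ-≤ z x≤y = +-mono-≤ x≤y ≤-refl

  x≤x+y : ∀ {x y} → 0# ≤ y → x ≤ x + y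
  x≤x+y {x} {y} 0≤y = begin
    x       ≈⟨ +-identityʳ x ⟨
    x + 0#  ≲⟨ +-monoʳ-≤ x 0≤y ⟩
    x + y   ∎

  -- A nonnegative factor of a positive product is invertible, hence
  -- apart from 0 and so positive.
  *-pos⁻ˡ : ∀ {x y} → 0# ≤ x → 0# < x * y → 0# < x
  *-pos⁻ˡ {x} {y} 0≤x 0<xy with inverse 0<xy
  ... | z , _ , xyz≈1 with Equivalence.to #⇔<⊎> x#0
    where
    x[yz]≈1 : (x - 0#) * (y * z) ≈ 1#
    x[yz]≈1 = trans (*-congʳ (x-0≈x x)) (trans (sym (*-assoc _ _ _)) xyz≈1)
    x#0 : x # 0#
    x#0 = invertible⇒# (y * z , trans (*-comm _ _) x[yz]≈1 , x[yz]≈1)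
  ...   | inj₁ x<0 = contradiction x<0 0≤x
  ...   | inj₂ 0<x = 0<x

  *-cancelˡ-< : ∀ {x y z} → 0# < z → z * x < z * y → x < y
  *-cancelˡ-< {z = z} 0<z zx<zy with inverse 0<z
  ... | z⁻¹ , 0<z⁻¹ , zz⁻¹≈1 =
    <-respʳ-≈ (cancel _) (<-respˡ-≈ (cancel _) (*-monoˡ-< 0<z⁻¹ zx<zy))
    where
    cancel : ∀ x → z⁻¹ * (z * x) ≈ x
    cancel x = trans (sym (*-assoc _ _ _))
      (trans (*-congʳ (trans (*-comm _ _) zz⁻¹≈1)) (*-identityˡ x))

  *-cancelˡ-≤ : ∀ {x y z} → 0# < z → z * x ≤ z * y → x ≤ y
  *-cancelˡ-≤ 0<z zx≤zy y<x = zx≤zy (*-monoˡ-< 0<z y<x)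

  *-monoʳ-≤ : ∀ {x y z} → 0# ≤ z → x ≤ y → z * x ≤ z * y
  *-monoʳ-≤ {x} {y} {z} 0≤z x≤y zy<zx = x≤y (*-cancelˡ-< 0<z zy<zx)
    where
    eq : z * x - z * y ≈ z * (x - y)
    eq = trans (+-congˡ (-‿distribʳ-* z y)) (sym (distribˡ z x (- y)))
    0<z : 0# < z
    0<z = *-pos⁻ˡ 0≤z (<-respʳ-≈ eq (x<y⇒0<y-x zy<zx))

  *-monoˡ-≤ : ∀ {x y z} → 0# ≤ z → x ≤ y → x * z ≤ y * z
  *-monoˡ-≤ {x} {y} {z} 0≤z x≤y = begin
    x * z  ≈⟨ *-comm x z ⟩
    z * x  ≲⟨ *-monoʳ-≤ 0≤z x≤y ⟩
    z * y  ≈⟨ *-comm z y ⟩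
    y * z  ∎

  *-nonneg : ∀ {x y} → 0# ≤ x → 0# ≤ y → 0# ≤ x * y
  *-nonneg {x} 0≤x 0≤y = ≤-trans (≤-reflexive (sym (zeroʳ x))) (*-monoʳ-≤ 0≤x 0≤y)

  +-nonneg : ∀ {x y} → 0# ≤ x → 0# ≤ y → 0# ≤ x + y
  +-nonneg 0≤x 0≤y = ≤-trans 0≤x (x≤x+y 0≤y)

-- Searches with reliable answers

opposite : Target → Target
opposite first  = second
opposite second = first

-- Decision trees of depth at most r with reliable answers: asking about
-- a vertex v gives the directions at v to both targets, in no particular
-- order.
data Search (n : ℕ) : ℕ → Set where
  answer : ∀ {r} → Fin n × Fin n → Search n r
  ask    : ∀ {r s} → s ℕ.< r → Fin n → (Fin n → Fin n → Search n s) → Search n r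

-- Paths in a tree, and what a query tells

-- What a reply to a query at v tells about the target.
direction : ∀ {n} → Fin n → Reply n → Fin n
direction v found      = v
direction v (toward u) = u

module Trees {c ℓ₁ ℓ₂} (R : RealNumbers c ℓ₁ ℓ₂) {n}
             (G : WeightedGraph R n) (tree : WeightedGraph.IsTree G) where
  open WeightedGraph G
  private
    module ℝ where
      open RealNumbers R public
      open RealProperties R public
      open Order R public
  open DecMembership (_≟_ {n}) using (_∈?_)

  start∈ : ∀ {u v} (p : Walk u v) → u ∈ vertices p
  start∈ ε       = here ≡.refl
  start∈ (_ ◅ _) = here ≡.refl

  end∈ : ∀ {u v} (p : Walk u v) → v ∈ vertices p
  end∈ ε       = here ≡.refl
  end∈ (_ ◅ p) = there (end∈ p)

  -- The part of a walk from a vertex a on it to the end.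
  record Suffix {u v} (p : Walk u v) (a : Fin n) : Set ℓ₂ where
    field
      walk      : Walk a v
      ⊆-whole   : vertices walk ⊆ vertices p
      unique    : Unique (vertices p) → Unique (vertices walk)
      shorter   : length walk ℕ.≤ length p
      lighter   : weight walk ℝ.≤ weight p

  suffix : ∀ {u v a} (p : Walk u v) → a ∈ vertices p → Suffix p a
  suffix ε (here ≡.refl) = record
    { walk = ε ; ⊆-whole = id ; unique = id
    ; shorter = ℕ.≤-refl ; lighter = ℝ.≤-refl }
  suffix (e ◅ p) (here ≡.refl) = record
    { walk = e ◅ p ; ⊆-whole = id ; unique = id
    ; shorter = ℕ.≤-refl ; lighter = ℝ.≤-refl }
  suffix (e ◅ p) (there a∈p) = record
    { walk    = walk
    ; ⊆-whole = there ∘ ⊆-whole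
    ; unique  = unique ∘ AllPairs.tail
    ; shorter = ℕ.m≤n⇒m≤1+n shorter
    ; lighter = ℝ.≤-trans lighter (ℝ.≤-trans (ℝ.x≤x+y (ℝ.<⇒≤ (w-positive e)))
                  (ℝ.≤-reflexive (ℝ.+-comm _ _)))
    }
    where open Suffix (suffix p a∈p)

  -- A walk with the same ends as p, no longer than p, on vertices of p without
  -- repetition.
  record SimplePath {u v} (p : Walk u v) : Set where
    field
      path    : Walk u v
      unique  : Unique (vertices path)
      ⊆-whole : vertices path ⊆ vertices p
      shorter : length path ℕ.≤ length p

  unique-∷ : ∀ {u} {us : List (Fin n)} → u ∉ us → Unique us → Unique (u ∷ us)
  unique-∷ u∉us us! = ¬Any⇒All¬ _ u∉us AllPairs.∷ us!

  unique-head : ∀ {u} {us : List (Fin n)} → Unique (u ∷ us) → u ∉ us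
  unique-head = All¬⇒¬Any ∘ AllPairs.head

  -- Loop erasure.  If the start u of the first step reappears later, the walk
  -- up to there is dropped.
  simplify : ∀ {u v} (p : Walk u v) → SimplePath p
  simplify ε = record
    { path = ε ; unique = unique-∷ (λ ()) AllPairs.[] ; ⊆-whole = id ; shorter = ℕ.≤-refl }
  simplify {u} (e ◅ p) with simplify p
  ... | record { path = q ; unique = q! ; ⊆-whole = q⊆p ; shorter = q≤p } with u ∈? vertices q
  ...   | yes u∈q = record
    { path    = walk
    ; unique  = unique q!
    ; ⊆-whole = there ∘ q⊆p ∘ ⊆-whole
    ; shorter = ℕ.≤-trans shorter (ℕ.m≤n⇒m≤1+n q≤p)
    }
    where open Suffix (suffix q u∈q)
  ...   | no u∉q = record
    { path    = e ◅ q
    ; unique  = unique-∷ u∉q q!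
    ; ⊆-whole = ∷⁺ʳ u q⊆p
    ; shorter = s≤s q≤p
    }

  -- Walks in the graph without the vertex v, except that the empty walk
  -- from v is not excluded.
  Avoiding : Fin n → Fin n → Fin n → Set
  Avoiding v = Star (λ a b → Adj a b × a ≢ v × b ≢ v)

  avoiding⁺ : ∀ {v a b} (p : Walk a b) → v ∉ vertices p → Avoiding v a b
  avoiding⁺ ε _ = ε
  avoiding⁺ (e ◅ p) v∉ =
    (e , (λ a≡v → v∉ (here (≡.sym a≡v)))
       , (λ b≡v → v∉ (there (≡.subst (_∈ vertices p) b≡v (start∈ p)))))
    ◅ avoiding⁺ p (v∉ ∘ there)

  avoiding⁻ : ∀ {v a b} → a ≢ v → Avoiding v a b → Σ[ p ∈ Walk a b ] v ∉ vertices p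
  avoiding⁻ a≢v ε = ε , λ { (here v≡a) → a≢v (≡.sym v≡a) }
  avoiding⁻ a≢v ((e , _ , b≢v) ◅ p) with avoiding⁻ b≢v p
  ... | q , v∉q = e ◅ q , λ { (here v≡a) → a≢v (≡.sym v≡a) ; (there v∈q) → v∉q v∈q }

  avoiding-reverse : ∀ {v a b} → Avoiding v a b → Avoiding v b a
  avoiding-reverse = reverse λ (e , a≢v , b≢v) → adj-sym e , b≢v , a≢v

  adj⇒≢ : ∀ {u v} → Adj v u → u ≢ v
  adj⇒≢ e u≡v = adj-irrefl (≡.sym u≡v) e

  -- The neighbour u of v leads to x: u and x lie in the same component of
  -- the graph without v.
  Via : Fin n → Fin n → Fin n → Set
  Via v u x = Adj v u × Avoiding v u x

  -- Two different such neighbours would close a cycle through v.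
  via-unique : ∀ {v u u′ x} → Via v u x → Via v u′ x → u ≡ u′
  via-unique {v} {u} {u′} (e , p) (e′ , p′) with u ≟ u′
  ... | yes u≡u′ = u≡u′
  ... | no u≢u′ with avoiding⁻ (adj⇒≢ e) (p ◅◅ avoiding-reverse p′)
  ...   | q , v∉q = contradiction cycle (proj₂ tree)
    where
    open SimplePath (simplify q)
    nonempty : ∀ (q : Walk u u′) → 1 ℕ.≤ length q
    nonempty ε       = contradiction ≡.refl u≢u′
    nonempty (_ ◅ _) = s≤s z≤n
    cycle : Cycle
    cycle = v , u′ , e ◅ path , unique-∷ (v∉q ∘ ⊆-whole) unique
          , s≤s (nonempty path) , adj-sym e′

  simplePath : ∀ u v → Walk u v
  simplePath u v = SimplePath.path (simplify (proj₁ tree u v))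

  simplePath-unique : ∀ u v → Unique (vertices (simplePath u v))
  simplePath-unique u v = SimplePath.unique (simplify (proj₁ tree u v))

  second-vertex : ∀ {u v} → Walk u v → Fin n
  second-vertex {u} ε = u
  second-vertex (_◅_ {j = j} _ _) = j

  -- The neighbour of v on the path to x, or v itself for x ≡ v.  It names
  -- the component of x in the tree without v, and is what a query at v
  -- that directs to x tells.
  hop : Fin n → Fin n → Fin n
  hop v x = second-vertex (simplePath v x)

  simple-via : ∀ {v u x} (e : Adj v u) (p : Walk u x) → Unique (vertices (e ◅ p)) → Via v u x
  simple-via e p e◅p! = e , avoiding⁺ p (unique-head e◅p!)

  hop-self : ∀ v → hop v v ≡ v
  hop-self v with simplePath v v | simplePath-unique v v
  ... | ε     | _    = ≡.refl
  ... | e ◅ p | e◅p! = contradiction (end∈ p) (unique-head e◅p!)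

  hop-via : ∀ {v x} → v ≢ x → Via v (hop v x) x
  hop-via {v} {x} v≢x with simplePath v x | simplePath-unique v x
  ... | ε     | _    = contradiction ≡.refl v≢x
  ... | e ◅ p | e◅p! = simple-via e p e◅p!

  avoiding-end : ∀ {v a b} → a ≢ v → Avoiding v a b → b ≢ v
  avoiding-end a≢v ε                   = a≢v
  avoiding-end a≢v ((_ , _ , b≢v) ◅ p) = avoiding-end b≢v p

  hop-unique : ∀ {v u x} → Via v u x → hop v x ≡ u
  hop-unique (e , p) =
    via-unique (hop-via (avoiding-end (adj⇒≢ e) p ∘ ≡.sym)) (e , p)

  hop-fixed : ∀ {v x} → hop v x ≡ v → v ≡ x
  hop-fixed {v} {x} hop≡v with v ≟ x
  ... | yes v≡x = v≡x
  ... | no v≢x = contradiction hop≡v (adj⇒≢ (proj₁ (hop-via v≢x)))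

  -- The walk from x to v and on to t meets x only at its start.
  hop-separated : ∀ {v x t} → x ≢ v → hop v x ≢ hop v t → hop x t ≡ hop x v
  hop-separated {v} {x} {t} x≢v hop≢ with v ≟ t
  ... | yes ≡.refl = ≡.refl
  ... | no v≢t with hop-via x≢v | hop-via v≢t
  ...   | e , p | e′ , p′ =
    hop-unique (e , p ◅◅ ((e′ , x≢v ∘ ≡.sym , not-x (e′ , ε)) ◅ avoid-x (e′ , ε) p′))
    where
    not-x : ∀ {a} → Via v (hop v t) a → a ≢ x
    not-x via ≡.refl = hop≢ (hop-unique via)
    avoid-x : ∀ {a b} → Via v (hop v t) a → Avoiding v a b → Avoiding x a b
    avoid-x via ε = ε
    avoid-x via@(e , p) (s@(f , _) ◅ q) =
      (f , not-x via , not-x via′) ◅ avoid-x via′ q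
      where via′ = e , p ◅◅ (s ◅ ε)

  -- If a shortest walk from u to t visited v, then d(v,t) ≤ d(u,t), contrary
  -- to d(v,t) = w(vu) + d(u,t).  So u leads to t.
  direction-correct : ∀ {v t r} → Directs R G v t r → direction v r ≡ hop v t
  direction-correct {v} (found ≡.refl) = ≡.sym (hop-self v)
  direction-correct {v} {t} (toward {u} e (r , s , (_ , r≤) , ((p , p≈s) , _) , r≈w+s)) =
    ≡.sym (hop-unique (e , avoiding⁺ p v∉p))
    where
    v∉p : v ∉ vertices p
    v∉p v∈p = r≤s s<r
      where
      open Suffix (suffix p v∈p)
      r≤s : r ℝ.≤ s
      r≤s = ℝ.≤-trans (r≤ walk) (ℝ.≤-trans lighter (ℝ.≤-reflexive p≈s))
      s<r : s ℝ.< r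
      s<r = ℝ.<-respʳ-≈ (ℝ.sym r≈w+s) (ℝ.<-respˡ-≈ (ℝ.+-identityˡ s)
              (ℝ.+-monoˡ-< s (w-positive e)))

  -- The number of edges between two vertices.
  δ : Fin n → Fin n → ℕ
  δ u v = length (simplePath u v)

  -- By uniqueness of the first step, simple paths with the same ends visit
  -- the same vertices.
  simple-length : ∀ {u v} (p q : Walk u v) → Unique (vertices p) → Unique (vertices q) →
                  length p ≡ length q
  simple-length ε ε _ _ = ≡.refl
  simple-length ε (_ ◅ q) _ q! = contradiction (end∈ q) (unique-head q!)
  simple-length (_ ◅ p) ε p! _ = contradiction (end∈ p) (unique-head p!)
  simple-length (e ◅ p) (f ◅ q) p! q!
    with ≡.refl ← via-unique (simple-via e p p!) (simple-via f q q!) =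
    ≡.cong suc (simple-length p q (AllPairs.tail p!) (AllPairs.tail q!))

  δ-shortest : ∀ {u v} (p : Walk u v) → δ u v ℕ.≤ length p
  δ-shortest {u} {v} p = ℕ.≤-trans
    (ℕ.≤-reflexive (simple-length (simplePath u v) path (simplePath-unique u v) unique))
    shorter
    where open SimplePath (simplify p)

  δ-adjacent : ∀ {u v} → Adj v u → ∀ x → δ u x ℕ.≤ suc (δ v x)
  δ-adjacent {v = v} e x = δ-shortest (adj-sym e ◅ simplePath v x)

  δ-hop : ∀ {v x} → v ≢ x → suc (δ (hop v x) x) ℕ.≤ δ v x
  δ-hop {v} {x} v≢x with simplePath v x
  ... | ε     = contradiction ≡.refl v≢x
  ... | _ ◅ p = s≤s (δ-shortest p)

  total-δ : List (Fin n) → Fin n → ℕ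
  total-δ B v = sum (map (δ v) B)

  -- A vertex whose distances to the members of B, counted with multiplicity,
  -- have the least sum.  The root is only an initial value for the minimum.
  median : Fin n → List (Fin n) → Fin n
  median root B = argmin (total-δ B) root (allFin n)

  median-least : ∀ root B u → total-δ B (median root B) ℕ.≤ total-δ B u
  median-least root B u = All.lookup (f[argmin]≤f[xs] root (allFin n)) (∈-allFin u)

  -- The members x of B with hop v x ≡ d.
  component : Fin n → Fin n → List (Fin n) → List (Fin n)
  component v d = filter (λ x → hop v x ≟ d)

  -- A step from v to d brings the members of B behind d closer by one,
  -- and takes the others away by at most one.
  total-δ-step : ∀ {v d} → Adj v d → ∀ B →
    total-δ B d ℕ.+ 2 ℕ.* List.length (component v d B) ℕ.≤ total-δ B v ℕ.+ List.length B
  total-δ-step e [] = z≤n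
  total-δ-step {v} {d} e (x ∷ B) with hop v x ≟ d
  ... | yes ≡.refl = begin
    δ d x ℕ.+ S ℕ.+ 2 ℕ.* suc k      ≡⟨ left (δ d x) S k ⟩
    suc (δ d x) ℕ.+ (S ℕ.+ 2 ℕ.* k) ℕ.+ 1
      ≤⟨ ℕ.+-monoˡ-≤ 1 (ℕ.+-mono-≤ (δ-hop v≢x) (total-δ-step e B)) ⟩
    δ v x ℕ.+ (T ℕ.+ l) ℕ.+ 1         ≡⟨ right (δ v x) T l ⟩
    δ v x ℕ.+ T ℕ.+ suc l             ∎
    where
    open ℕ.≤-Reasoning
    S = total-δ B d
    T = total-δ B v
    k = List.length (component v d B)
    l = List.length B
    v≢x : v ≢ x
    v≢x ≡.refl = adj⇒≢ e (hop-self v)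
    left : ∀ a S k → a ℕ.+ S ℕ.+ 2 ℕ.* suc k ≡ suc a ℕ.+ (S ℕ.+ 2 ℕ.* k) ℕ.+ 1
    left = solve-∀
    right : ∀ b T l → b ℕ.+ (T ℕ.+ l) ℕ.+ 1 ≡ b ℕ.+ T ℕ.+ suc l
    right = solve-∀
  ... | no _ = begin
    δ d x ℕ.+ S ℕ.+ 2 ℕ.* k           ≡⟨ ℕ.+-assoc (δ d x) S _ ⟩
    δ d x ℕ.+ (S ℕ.+ 2 ℕ.* k)         ≤⟨ ℕ.+-mono-≤ (δ-adjacent e x) (total-δ-step e B) ⟩
    suc (δ v x) ℕ.+ (T ℕ.+ l)         ≡⟨ right (δ v x) T l ⟩
    δ v x ℕ.+ T ℕ.+ suc l             ∎
    where
    open ℕ.≤-Reasoning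
    S = total-δ B d
    T = total-δ B v
    k = List.length (component v d B)
    l = List.length B
    right : ∀ b T l → suc b ℕ.+ (T ℕ.+ l) ≡ b ℕ.+ T ℕ.+ suc l
    right = solve-∀

  -- No component of the tree without the median contains more than half of B.
  median-halves : ∀ root B {x} → let v = median root B in
    v ≢ x → 2 ℕ.* List.length (component v (hop v x) B) ℕ.≤ List.length B
  median-halves root B {x} v≢x = ℕ.+-cancelˡ-≤ (total-δ B v) _ _
    (ℕ.≤-trans (ℕ.+-monoˡ-≤ _ (median-least root B (hop v x)))
               (total-δ-step (proj₁ (hop-via v≢x)) B))
    where
    v = median root B

  -- The search by halving

  -- The search outputs the targets t if each answer along its way is the
  -- pair of the directions to them, in either order.
  Solves : (Target → Fin n) → ∀ {r} → Search n r → Set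
  Solves t (answer z)  = DetectsBoth t z
  Solves t (ask _ v f) =
    ∀ τ → Solves t (f (hop v (t τ)) (hop v (t (opposite τ))))

  -- The candidates in the direction d from v.  Direction v leaves v alone, once,
  -- even if it occurs several times in B.
  restrict : Fin n → Fin n → List (Fin n) → List (Fin n)
  restrict v d B = if does (d ≟ v) then List.[ v ] else component v d B

  ∈-restrict : ∀ v {x B} → x ∈ B → x ∈ restrict v (hop v x) B
  ∈-restrict v {x} x∈B with hop v x ≟ v
  ... | yes hop≡v = here (≡.sym (hop-fixed hop≡v))
  ... | no _      = ∈-filter⁺ (λ y → hop v y ≟ hop v x) x∈B ≡.refl

  -- The root serves as a default value.
  module _ (root : Fin n) where

    -- In direction v a single candidate is left, otherwise at most half of them.
    restrict-halves : ∀ i B x → let v = median root B in List.length B ℕ.< 2 ℕ.^ suc (suc i) →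
      List.length (restrict v (hop v x) B) ℕ.< 2 ℕ.^ suc i
    restrict-halves i B x small with hop (median root B) x ≟ median root B
    ... | yes _    = ℕ.*-monoʳ-≤ 2 (ℕ.m^n>0 2 i)
    ... | no hop≢v = ℕ.*-cancelˡ-< 2 _ _ (ℕ.≤-<-trans (median-halves root B v≢x) small)
      where
      v≢x : median root B ≢ x
      v≢x v≡x = hop≢v (≡.subst (λ y → hop y x ≡ y) (≡.sym v≡x) (hop-self x))

    -- The member of a singleton list.
    the : List (Fin n) → Fin n
    the []      = root
    the (x ∷ _) = x

    the-∈ : ∀ {B x} → List.length B ℕ.< 2 → x ∈ B → the B ≡ x
    the-∈ {_ ∷ []}    _             (here x≡y) = ≡.sym x≡y
    the-∈ {_ ∷ _ ∷ _} (s≤s (s≤s ())) _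

    -- The entry of the unordered pair a , b that remains when c is removed.
    other : Fin n → Fin n → Fin n → Fin n
    other c a b = if does (c ≟ a) then b else a

    other-left : ∀ c b → other c c b ≡ b
    other-left c b with c ≟ c
    ... | yes _  = ≡.refl
    ... | no c≢c = contradiction ≡.refl c≢c

    other-right : ∀ c a → other c a c ≡ a
    other-right c a with c ≟ a
    ... | yes c≡a = c≡a
    ... | no _    = ≡.refl

    -- The direction at x to the target that lies in the direction d from v, when
    -- the other target does not, computed from the unordered pair a , b of the
    -- directions at x to both.  For x ≢ v, if hop v x ≡ d then hop x v is the
    -- direction to the other target, and otherwise to the target itself.
    resolve : Fin n → Fin n → Fin n → Fin n → Fin n → Fin n
    resolve v d x a b =
      if does (x ≟ v) then d else
      if does (hop v x ≟ d) then other (hop x v) a b else hop x v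

    resolve-correct : ∀ {v s t} x → hop v s ≢ hop v t →
      resolve v (hop v s) x (hop x s) (hop x t) ≡ hop x s ×
      resolve v (hop v s) x (hop x t) (hop x s) ≡ hop x s
    resolve-correct {v} {s} {t} x s≢t with x ≟ v
    ... | yes ≡.refl = ≡.refl , ≡.refl
    ... | no x≢v with hop v x ≟ hop v s
    ...   | yes x≡s rewrite hop-separated x≢v (s≢t ∘ ≡.trans (≡.sym x≡s)) =
      other-right (hop x v) (hop x s) , other-left (hop x v) (hop x s)
    ...   | no x≢s rewrite hop-separated x≢v x≢s = ≡.refl , ≡.refl

    -- Locates by i halvings, among the candidates B, the target that lies in the
    -- direction d from v when the other target does not, and then goes on.
    locate : ∀ {s} i → Fin n → Fin n → List (Fin n) → (Fin n → Search n s) → Search n (i ℕ.+ s)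
    locate zero    v d B next = next (the B)
    locate (suc i) v d B next = ask ℕ.≤-refl x λ a b →
      locate i v d (restrict x (resolve v d x a b) B) next
      where x = median root B

    -- Locates both targets among the candidates B.  Once an answer separates them,
    -- they are located one after the other.
    locateBoth : ∀ i → List (Fin n) → Search n (2 ℕ.* i)
    locateBoth zero    B = answer (the B , the B)
    locateBoth (suc i) B = ask (ℕ.*-monoʳ-< 2 (ℕ.n<1+n i)) v λ a b →
      if does (a ≟ b) then locateBoth i (restrict v a B)
      else locate i v a (restrict v a B) (λ x →
           locate i v b (restrict v b B) (λ y → answer (x , y)))
      where v = median root B

    module _ (t : Target → Fin n) where

      locate-solves : ∀ {s} i {v B} {next : Fin n → Search n s} τ →
        hop v (t τ) ≢ hop v (t (opposite τ)) →
        t τ ∈ B → List.length B ℕ.< 2 ℕ.^ suc i → Solves t (next (t τ)) →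
        Solves t (locate i v (hop v (t τ)) B next)
      locate-solves zero {next = next} τ _ t∈B small solves
        rewrite the-∈ small t∈B = solves
      locate-solves (suc i) {v} {B} {next} τ apart t∈B small solves σ =
        ≡.subst (λ d → Solves t (locate i v (hop v (t τ)) (restrict x d B) next))
          (≡.sym (resolved τ σ apart))
          (locate-solves i τ apart (∈-restrict x t∈B) (restrict-halves i B (t τ) small) solves)
        where
        x = median root B
        resolved : ∀ τ σ → hop v (t τ) ≢ hop v (t (opposite τ)) →
          resolve v (hop v (t τ)) x (hop x (t σ)) (hop x (t (opposite σ))) ≡ hop x (t τ)
        resolved first  first  apart = proj₁ (resolve-correct x apart)
        resolved first  second apart = proj₂ (resolve-correct x apart)
        resolved second first  apart = proj₂ (resolve-correct x apart)
        resolved second second apart = proj₁ (resolve-correct x apart)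

      locateBoth-solves : ∀ i {B} → (∀ τ → t τ ∈ B) → List.length B ℕ.< 2 ℕ.^ suc i →
        Solves t (locateBoth i B)
      locateBoth-solves zero t∈B small =
        inj₁ (the-∈ small (t∈B first) , the-∈ small (t∈B second))
      locateBoth-solves (suc i) {B} t∈B small σ
        with hop (median root B) (t σ) ≟ hop (median root B) (t (opposite σ))
      ... | yes together = locateBoth-solves i
        (λ τ → ≡.subst (λ d → t τ ∈ restrict v d B) (same σ τ together) (∈-restrict v (t∈B τ)))
        (restrict-halves i B (t σ) small)
        where
        v = median root B
        same : ∀ σ τ → hop v (t σ) ≡ hop v (t (opposite σ)) → hop v (t τ) ≡ hop v (t σ)
        same first  first  _  = ≡.refl
        same first  second eq = ≡.sym eq
        same second first  eq = ≡.sym eq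
        same second second _  = ≡.refl
      ... | no apart =
        locate-solves i σ apart (∈-restrict v (t∈B σ)) (restrict-halves i B (t σ) small)
          (locate-solves i (opposite σ) (apart-opposite σ apart) (∈-restrict v (t∈B (opposite σ)))
            (restrict-halves i B (t (opposite σ)) small) (detects σ))
        where
        v = median root B
        apart-opposite : ∀ σ → hop v (t σ) ≢ hop v (t (opposite σ)) →
          hop v (t (opposite σ)) ≢ hop v (t (opposite (opposite σ)))
        apart-opposite first  apart = apart ∘ ≡.sym
        apart-opposite second apart = apart ∘ ≡.sym
        detects : ∀ σ → DetectsBoth t (t σ , t (opposite σ))
        detects first  = inj₁ (≡.refl , ≡.refl)
        detects second = inj₂ (≡.refl , ≡.refl)

-- From answers to queries

-- Queries v up to j more times after a reply that told a, until a reply tells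
-- something else, and goes on with the pair of what was told, or with a twice.
-- One of these replies is processed by hear.
again : ∀ {n} → ℕ → Fin n → Fin n → (Fin n → Fin n → Strategy n) → Strategy n
hear  : ∀ {n} → ℕ → Fin n → Fin n → (Fin n → Fin n → Strategy n) → Reply n → Strategy n

again zero    v a next = next a a
again (suc j) v a next = query v (hear j v a next)

hear j v a next r =
  if does (a ≟ direction v r) then again j v a next else next a (direction v r)

-- Replaces each question by at most 1 + j queries.
compile : ∀ {n r} → ℕ → Search n r → Strategy n
compile j (answer z)  = output z
compile j (ask _ v f) = query v λ r → again j v (direction v r) λ a b → compile j (f a b)

queries-query : ∀ {n b} v (next : Reply n → Strategy n) →
  (∀ r → queries (next r) ℕ.≤ b) → queries (query v next) ℕ.≤ suc b
queries-query {b = b} v next next≤b =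
  s≤s (ℕ.⊔-lub (next≤b found) (foldr-⊔ (λ u → queries (next (toward u))) (next≤b ∘ toward)))
  where
  foldr-⊔ : ∀ {m} (f : Fin m → ℕ) → (∀ i → f i ℕ.≤ b) → Vector.foldr ℕ._⊔_ 0 f ℕ.≤ b
  foldr-⊔ {zero}  f f≤b = z≤n
  foldr-⊔ {suc m} f f≤b = ℕ.⊔-lub (f≤b zero) (foldr-⊔ (f ∘ suc) (f≤b ∘ suc))

queries-again : ∀ {n b} j (v a : Fin n) {next} → (∀ a b′ → queries (next a b′) ℕ.≤ b) →
  queries (again j v a next) ℕ.≤ j ℕ.+ b
queries-again zero    v a next≤b = next≤b a a
queries-again {b = b} (suc j) v a {next} next≤b = queries-query v _ step
  where
  step : ∀ r → queries (hear j v a next r) ℕ.≤ j ℕ.+ b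
  step r with a ≟ direction v r
  ... | yes _ = queries-again j v a next≤b
  ... | no _  = ℕ.≤-trans (next≤b a (direction v r)) (ℕ.m≤n+m b j)

queries-compile : ∀ {n r} j (s : Search n r) → queries (compile j s) ℕ.≤ r ℕ.* suc j
queries-compile j (answer _) = z≤n
queries-compile j (ask {s = s} s<r v f) = ℕ.≤-trans
  (queries-query v _ λ r → queries-again j v (direction v r) λ a b → queries-compile j (f a b))
  (ℕ.*-monoˡ-≤ (suc j) s<r)

-- Failure probability

module Probability {c ℓ₁ ℓ₂} (R : RealNumbers c ℓ₁ ℓ₂) where
  open RealNumbers R hiding (zero)
  open RealProperties R
  open Order R
  open import Algebra.Properties.Semiring.Exp semiring using (_^_)
  private
    module S = SemiringSolver (CommutativeRing.commutativeSemiring commutativeRing)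
  open S using (solve; _:=_; _:+_; _:*_)

  module _ {A : Set} {P : U.Pred A 0ℓ} (P? : U.Decidable P) where

    Pr-++ : ∀ xs ys → Pr R P? (xs ++ ys) ≈ Pr R P? xs + Pr R P? ys
    Pr-++ [] ys = sym (+-identityˡ _)
    Pr-++ ((p , x) ∷ xs) ys with does (P? x)
    ... | true  = trans (+-congˡ (Pr-++ xs ys)) (sym (+-assoc _ _ _))
    ... | false = Pr-++ xs ys

    Pr-certain : ∀ {x} → P x → Pr R P? List.[ 1# , x ] ≈ 1#
    Pr-certain {x} px with P? x
    ... | yes _  = +-identityʳ 1#
    ... | no ¬px = contradiction px ¬px

    Pr-scale : ∀ q xs → Pr R P? (map (map₁ (q *_)) xs) ≈ q * Pr R P? xs
    Pr-scale q [] = sym (zeroʳ q)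
    Pr-scale q ((p , x) ∷ xs) with does (P? x)
    ... | true  = trans (+-congˡ (Pr-scale q xs)) (sym (distribˡ q p _))
    ... | false = Pr-scale q xs

  module _ (p₁ : Carrier) (0<p₁ : 0# < p₁) (p₁<1 : p₁ < 1#) where

    -- The probability that a query directs to a given target.
    prob : Target → Carrier
    prob first  = p₁
    prob second = 1# - p₁

    0≤prob : ∀ τ → 0# ≤ prob τ
    0≤prob first  = <⇒≤ 0<p₁
    0≤prob second = <⇒≤ (x<y⇒0<y-x p₁<1)

    prob-sum : ∀ x → prob first * x + prob second * x ≈ x
    prob-sum x = trans (sym (distribʳ x _ _))
      (trans (*-congʳ (trans (+-comm _ _) (x-y+y≈x 1# p₁))) (*-identityˡ x))

    module _ {n} {G : WeightedGraph R n} (tree : WeightedGraph.IsTree G)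
             (t : Target → Fin n) (responder : Responder R G t) where
      open Trees R G tree using (hop; direction-correct; Solves)
      open Responder responder

      -- The probability that a strategy, begun after the given history, outputs
      -- the targets.
      success : List Target → Strategy n → Carrier
      success history S = Pr R (detectsBoth? t) (runAfter R history p₁ responder S)

      -- The same for what follows a query at v that directed to τ.
      continued : List Target → Fin n → (Reply n → Strategy n) → Target → Carrier
      continued history v next τ = success (τ ∷ history) (next (reply history v τ))

      success-query : ∀ history v next →
        success history (query v next) ≈
          prob first * continued history v next first + prob second * continued history v next second
      success-query history v next =
        trans (Pr-++ P? (map _ (after first)) _)
          (+-cong (Pr-scale P? p₁ (after first)) (Pr-scale P? (1# - p₁) (after second)))
        where
        P? = detectsBoth? t
        after : Target → Distribution R (Fin n × Fin n)
        after τ = runAfter R (τ ∷ history) p₁ responder (next (reply history v τ))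

      success-nonneg : ∀ history S → 0# ≤ success history S
      success-nonneg history (output z) with does (detectsBoth? t z)
      ... | true  = +-nonneg (<⇒≤ 0<1) ≤-refl
      ... | false = ≤-refl
      success-nonneg history (query v next) =
        ≤-trans (+-nonneg (*-nonneg (0≤prob first) (success-nonneg _ (next (reply history v first))))
                          (*-nonneg (0≤prob second) (success-nonneg _ (next (reply history v second)))))
                (≤-reflexive (sym (success-query history v next)))

      -- Bounds on the failure probability are stated without subtraction, as
      -- 1 ≤ success + loss.
      query-loss : ∀ history v next (loss : Target → Carrier) →
        (∀ τ → 1# ≤ continued history v next τ + loss τ) →
        1# ≤ success history (query v next) + (prob first * loss first + prob second * loss second)
      query-loss history v next loss bound = begin
        1#                                          ≈⟨ prob-sum 1# ⟨
        p * 1# + q * 1#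
          ≲⟨ +-mono-≤ (*-monoʳ-≤ (0≤prob first) (bound first))
                      (*-monoʳ-≤ (0≤prob second) (bound second)) ⟩
        p * (x + loss first) + q * (y + loss second)
          ≈⟨ solve 6 (λ p q x y k l → p :* (x :+ k) :+ q :* (y :+ l) :=
                                      (p :* x :+ q :* y) :+ (p :* k :+ q :* l)) refl
               p q x y (loss first) (loss second) ⟩
        (p * x + q * y) + (p * loss first + q * loss second)
          ≈⟨ +-congʳ (success-query history v next) ⟨
        success history (query v next) + (p * loss first + q * loss second) ∎
        where
        p = prob first
        q = prob second
        x = continued history v next first
        y = continued history v next second

      query-loss-const : ∀ history v next loss →
        (∀ τ → 1# ≤ continued history v next τ + loss) →
        1# ≤ success history (query v next) + loss
      query-loss-const history v next loss bound = ≤-trans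
        (query-loss history v next (λ _ → loss) bound)
        (≤-reflexive (+-congˡ (prob-sum loss)))

      reply-direction : ∀ history v τ → direction v (reply history v τ) ≡ hop v (t τ)
      reply-direction history v τ = direction-correct (correct history v τ)

      -- If both targets lie in one direction, all replies agree.
      again-together : ∀ j v a next loss → (∀ τ → hop v (t τ) ≡ a) →
        (∀ history → 1# ≤ success history (next a a) + loss) →
        ∀ history → 1# ≤ success history (again j v a next) + loss
      again-together zero    v a next loss eq bound history = bound history
      again-together (suc j) v a next loss eq bound history =
        query-loss-const history v (hear j v a next) loss step
        where
        step : ∀ τ → 1# ≤ continued history v (hear j v a next) τ + loss
        step τ rewrite reply-direction history v τ | eq τ with a ≟ a
        ... | yes _  = again-together j v a next loss eq bound (τ ∷ history)
        ... | no a≢a = contradiction ≡.refl a≢a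

      -- If the targets are separated at v and the first query directed to τ, the
      -- other direction is missed only if j further queries direct to τ.
      again-apart : ∀ j v next loss τ → hop v (t τ) ≢ hop v (t (opposite τ)) → 0# ≤ loss →
        (∀ history → 1# ≤ success history (next (hop v (t τ)) (hop v (t (opposite τ)))) + loss) →
        ∀ history → 1# ≤ success history (again j v (hop v (t τ)) next) + (prob τ ^ j + loss)
      again-apart zero v next loss τ apart 0≤loss bound history = begin
        1#                      ≲⟨ x≤x+y (+-nonneg 0≤loss (success-nonneg history S)) ⟩
        1# + (loss + success history S)   ≈⟨ +-assoc _ _ _ ⟨
        (1# + loss) + success history S   ≈⟨ +-comm _ _ ⟩
        success history S + (1# + loss)   ∎
        where S = again zero v (hop v (t τ)) next
      again-apart (suc j) v next loss τ apart 0≤loss bound history = begin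
        1#  ≲⟨ query-loss history v (hear j v (hop v (t τ)) next) (losses τ) (step τ apart bound) ⟩
        success history S + (prob first * losses τ first + prob second * losses τ second)
          ≈⟨ +-congˡ (total τ) ⟩
        success history S + (prob τ ^ suc j + loss) ∎
        where
        S = again (suc j) v (hop v (t τ)) next
        -- The loss, as losses τ σ, once the next query has directed to σ: only
        -- σ ≡ τ leaves the other direction unknown.
        losses : Target → Target → Carrier
        losses first  first  = prob first ^ j + loss
        losses first  second = loss
        losses second first  = loss
        losses second second = prob second ^ j + loss
        p = prob first
        q = prob second
        total : ∀ τ → p * losses τ first + q * losses τ second ≈ prob τ ^ suc j + loss
        total first = trans
          (solve 4 (λ p q x l → p :* (x :+ l) :+ q :* l := p :* x :+ (p :* l :+ q :* l)) refl
            p q (p ^ j) loss)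
          (+-congˡ (prob-sum loss))
        total second = trans
          (solve 4 (λ p q x l → p :* l :+ q :* (x :+ l) := q :* x :+ (p :* l :+ q :* l)) refl
            p q (q ^ j) loss)
          (+-congˡ (prob-sum loss))
        module _ (τ : Target) (apart : hop v (t τ) ≢ hop v (t (opposite τ)))
          (bound : ∀ history → 1# ≤ success history (next (hop v (t τ)) (hop v (t (opposite τ)))) + loss)
          where
          after : Reply n → Strategy n
          after = hear j v (hop v (t τ)) next
          same : 1# ≤ continued history v after τ + (prob τ ^ j + loss)
          same rewrite reply-direction history v τ with hop v (t τ) ≟ hop v (t τ)
          ... | yes _  = again-apart j v next loss τ apart 0≤loss bound (τ ∷ history)
          ... | no a≢a = contradiction ≡.refl a≢a
          different : 1# ≤ continued history v after (opposite τ) + loss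
          different rewrite reply-direction history v (opposite τ)
            with hop v (t τ) ≟ hop v (t (opposite τ))
          ... | yes a≡b = contradiction a≡b apart
          ... | no _    = bound (opposite τ ∷ history)
        step : ∀ τ apart bound σ → 1# ≤ continued history v (after τ apart bound) σ + losses τ σ
        step first  apart bound first  = same first apart bound
        step first  apart bound second = different first apart bound
        step second apart bound first  = different second apart bound
        step second apart bound second = same second apart bound

      -- Each of the at most r questions is answered wrongly with probability at
      -- most e.
      compile-success : ∀ {r} j e → 0# ≤ e → (∀ τ → prob τ ^ j ≤ e) →
        (s : Search n r) → Solves t s →
        ∀ history → 1# ≤ success history (compile j s) + fromℕ r * e
      compile-success {r} j e 0≤e small (answer z) solves history =
        ≤-trans (≤-reflexive (sym (Pr-certain (detectsBoth? t) solves)))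
                (x≤x+y (*-nonneg (0≤fromℕ r) 0≤e))
      compile-success {r} j e 0≤e small (ask {s = s} s<r v f) solves history = begin
        1#                            ≲⟨ query-loss-const history v (λ r → again j v (direction v r) next) (e + fromℕ s * e) step ⟩
        success history S + (e + fromℕ s * e)
          ≈⟨ +-congˡ (trans (+-congʳ (sym (*-identityˡ e))) (sym (distribʳ e 1# (fromℕ s)))) ⟩
        success history S + fromℕ (suc s) * e
          ≲⟨ +-monoʳ-≤ _ (*-monoˡ-≤ 0≤e (fromℕ-mono s<r)) ⟩
        success history S + fromℕ r * e ∎
        where
        S = compile j (ask s<r v f)
        next : Fin n → Fin n → Strategy n
        next a b = compile j (f a b)
        0≤se : 0# ≤ fromℕ s * e
        0≤se = *-nonneg (0≤fromℕ s) 0≤e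
        bound : ∀ τ history →
          1# ≤ success history (next (hop v (t τ)) (hop v (t (opposite τ)))) + fromℕ s * e
        bound τ = compile-success j e 0≤e small (f _ _) (solves τ)
        together : ∀ τ → hop v (t τ) ≡ hop v (t (opposite τ)) → ∀ σ → hop v (t σ) ≡ hop v (t τ)
        together first  eq first  = ≡.refl
        together first  eq second = ≡.sym eq
        together second eq first  = ≡.sym eq
        together second eq second = ≡.refl
        step : ∀ τ → 1# ≤ continued history v (λ r → again j v (direction v r) next) τ
                           + (e + fromℕ s * e)
        step τ rewrite reply-direction history v τ with hop v (t τ) ≟ hop v (t (opposite τ))
        ... | yes eq = begin
          1#                                    ≲⟨ again-together j v (hop v (t τ)) next (fromℕ s * e)
                                                     (together τ eq) bound′ (τ ∷ history) ⟩
          success (τ ∷ history) A + fromℕ s * e ≲⟨ +-monoʳ-≤ _ (x≤x+y 0≤e) ⟩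
          success (τ ∷ history) A + (fromℕ s * e + e)
                                                ≈⟨ +-congˡ (+-comm _ _) ⟩
          success (τ ∷ history) A + (e + fromℕ s * e) ∎
          where
          A = again j v (hop v (t τ)) next
          bound′ : ∀ history → 1# ≤ success history (next (hop v (t τ)) (hop v (t τ))) + fromℕ s * e
          bound′ = ≡.subst
            (λ b → ∀ history → 1# ≤ success history (next (hop v (t τ)) b) + fromℕ s * e)
            (≡.sym eq) (bound τ)
        ... | no apart = ≤-trans
          (again-apart j v next (fromℕ s * e) τ apart 0≤se (bound τ) (τ ∷ history))
          (+-monoʳ-≤ _ (+-monoˡ-≤ _ (small τ)))

-- Choice of the parameters

n<2^n : ∀ n → n ℕ.< 2 ℕ.^ n
n<2^n zero    = s≤s z≤n
n<2^n (suc n) = ℕ.≤-trans (ℕ.+-mono-≤ (ℕ.m^n>0 2 n) (n<2^n n))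
                          (ℕ.+-monoʳ-≤ (2 ℕ.^ n) (ℕ.m≤m+n _ 0))

-- The integer part m of the binary logarithm of n.
floor-log₂ : ∀ n .{{_ : NonZero n}} → ∃[ m ] 2 ℕ.^ m ℕ.≤ n × n ℕ.< 2 ℕ.^ suc m
floor-log₂ (suc zero) = 0 , ℕ.≤-refl , ℕ.≤-refl
floor-log₂ (suc n@(suc _)) with floor-log₂ n
... | m , 2ᵐ≤n , n<2ᵐ⁺¹ with suc n ℕ.<? 2 ℕ.^ suc m
...   | yes small = m , ℕ.m≤n⇒m≤1+n 2ᵐ≤n , small
...   | no large  = suc m , ℕ.≮⇒≥ large
    , ℕ.≤-<-trans n<2ᵐ⁺¹ (ℕ.^-monoʳ-< 2 ℕ.≤-refl (ℕ.n<1+n (suc m)))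

module Estimates {c ℓ₁ ℓ₂} (R : RealNumbers c ℓ₁ ℓ₂) where
  open RealNumbers R hiding (zero)
  open RealProperties R
  open Order R
  open import Algebra.Properties.Semiring.Exp semiring using (_^_; ^-homo-*; ^-assocʳ)
  open import Algebra.Properties.Semiring.Mult semiring using (×1-homo-*)
  private
    module S = SemiringSolver (CommutativeRing.commutativeSemiring commutativeRing)
  open S using (solve; _:=_; _:+_; _:*_)

  *-≤1 : ∀ {x y} → 0# ≤ y → x ≤ 1# → y ≤ 1# → x * y ≤ 1#
  *-≤1 {x} {y} 0≤y x≤1 y≤1 = begin
    x * y   ≲⟨ *-monoˡ-≤ 0≤y x≤1 ⟩
    1# * y  ≈⟨ *-identityˡ y ⟩
    y       ≲⟨ y≤1 ⟩
    1#      ∎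

  ^-nonneg : ∀ {x} → 0# ≤ x → ∀ k → 0# ≤ x ^ k
  ^-nonneg 0≤x zero    = <⇒≤ 0<1
  ^-nonneg 0≤x (suc k) = *-nonneg 0≤x (^-nonneg 0≤x k)

  ^-≤1 : ∀ {x} → 0# ≤ x → x ≤ 1# → ∀ k → x ^ k ≤ 1#
  ^-≤1 0≤x x≤1 zero    = ≤-refl
  ^-≤1 0≤x x≤1 (suc k) = *-≤1 (^-nonneg 0≤x k) x≤1 (^-≤1 0≤x x≤1 k)

  -- Bernoulli's inequality (1 + δ) ^ k ≥ 1 + k δ combined with
  -- p (1 + δ) = 1 - δ ² ≤ 1.
  bernoulli : ∀ {p δ} → p + δ ≈ 1# → 0# ≤ p → 0# ≤ δ →
              ∀ k → p ^ k * (1# + fromℕ k * δ) ≤ 1#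
  bernoulli {p} {δ} p+δ≈1 0≤p 0≤δ zero = ≤-reflexive (trans (*-identityˡ _)
    (trans (+-congˡ (zeroˡ δ)) (+-identityʳ 1#)))
  bernoulli {p} {δ} p+δ≈1 0≤p 0≤δ (suc k) = begin
    (p * P) * (1# + (1# + K) * δ)
      ≈⟨ trans (distribˡ _ _ _) (+-cong (*-identityʳ _)
           (*-congˡ (trans (distribʳ _ _ _) (+-congʳ (*-identityˡ δ))))) ⟩
    p * P + (p * P) * (δ + K * δ)
      ≲⟨ x≤x+y (*-nonneg 0≤δ (*-nonneg (^-nonneg 0≤p k)
           (+-nonneg 0≤δ (*-nonneg (0≤fromℕ k) 0≤δ)))) ⟩
    (p * P + (p * P) * (δ + K * δ)) + δ * (P * (δ + K * δ))
      ≈⟨ solve 4 (λ p P δ K → (p :* P :+ (p :* P) :* (δ :+ K :* δ)) :+ δ :* (P :* (δ :+ K :* δ))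
                   := P :* p :+ (p :+ δ) :* (P :* (δ :+ K :* δ))) refl p P δ K ⟩
    P * p + (p + δ) * (P * (δ + K * δ))
      ≈⟨ +-congˡ (trans (*-congʳ p+δ≈1) (*-identityˡ _)) ⟩
    P * p + P * (δ + K * δ)
      ≈⟨ solve 4 (λ p P δ K → P :* p :+ P :* (δ :+ K :* δ)
                   := P :* ((p :+ δ) :+ K :* δ)) refl p P δ K ⟩
    P * ((p + δ) + K * δ)   ≈⟨ *-congˡ (+-congʳ p+δ≈1) ⟩
    P * (1# + K * δ)        ≲⟨ bernoulli p+δ≈1 0≤p 0≤δ k ⟩
    1#                      ∎
    where
    P = p ^ k
    K = fromℕ k

  -- The exponent k comes from the Archimedean property: k (1 - p) > 1.
  halving : ∀ {p} → 0# < p → p < 1# → ∃[ k ] fromℕ 2 * p ^ k ≤ 1#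
  halving {p} 0<p p<1 with inverse (x<y⇒0<y-x p<1)
  ... | y , _ , δy≈1 with archimedean y
  ...   | k , y<k = k , (begin
    fromℕ 2 * P                ≈⟨ *-comm _ _ ⟩
    P * fromℕ 2
      ≲⟨ *-monoʳ-≤ (^-nonneg (<⇒≤ 0<p) k) (+-monoʳ-≤ 1# (≤-trans (≤-reflexive (+-identityʳ 1#)) 1≤kδ)) ⟩
    P * (1# + fromℕ k * δ)     ≲⟨ bernoulli p+δ≈1 (<⇒≤ 0<p) (<⇒≤ 0<δ) k ⟩
    1#                         ∎)
    where
    P = p ^ k
    δ = 1# - p
    0<δ : 0# < δ
    0<δ = x<y⇒0<y-x p<1
    p+δ≈1 : p + δ ≈ 1#
    p+δ≈1 = trans (+-comm _ _) (x-y+y≈x 1# p)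
    1≤kδ : 1# ≤ fromℕ k * δ
    1≤kδ = <⇒≤ (<-respˡ-≈ δy≈1 (<-respʳ-≈ (*-comm _ _) (*-monoˡ-< 0<δ y<k)))

  halving-+ : ∀ {p} → 0# < p → p < 1# → ∀ k l →
              fromℕ 2 * p ^ k ≤ 1# → fromℕ 2 * p ^ (k ℕ.+ l) ≤ 1#
  halving-+ {p} 0<p p<1 k l 2pᵏ≤1 = begin
    fromℕ 2 * p ^ (k ℕ.+ l)       ≈⟨ *-congˡ (^-homo-* p k l) ⟩
    fromℕ 2 * (p ^ k * p ^ l)     ≈⟨ *-assoc _ _ _ ⟨
    (fromℕ 2 * p ^ k) * p ^ l
      ≲⟨ *-≤1 (^-nonneg (<⇒≤ 0<p) l) 2pᵏ≤1 (^-≤1 (<⇒≤ 0<p) (<⇒≤ p<1) l) ⟩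
    1#                            ∎

  exponential-decay : ∀ {y} → 0# ≤ y → fromℕ 2 * y ≤ 1# → ∀ i → fromℕ (2 ℕ.^ i) * y ^ i ≤ 1#
  exponential-decay 0≤y 2y≤1 zero =
    ≤-reflexive (trans (*-identityʳ _) (+-identityʳ 1#))
  exponential-decay {y} 0≤y 2y≤1 (suc i) = begin
    fromℕ (2 ℕ.* 2 ℕ.^ i) * (y * y ^ i)
      ≈⟨ *-congʳ (×1-homo-* 2 (2 ℕ.^ i)) ⟩
    (fromℕ 2 * fromℕ (2 ℕ.^ i)) * (y * y ^ i)
      ≈⟨ solve 4 (λ a b y z → (a :* b) :* (y :* z) := (a :* y) :* (b :* z)) refl
           (fromℕ 2) (fromℕ (2 ℕ.^ i)) y (y ^ i) ⟩
    (fromℕ 2 * y) * (fromℕ (2 ℕ.^ i) * y ^ i)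
      ≲⟨ *-≤1 (*-nonneg (0≤fromℕ (2 ℕ.^ i)) (^-nonneg 0≤y i)) 2y≤1
              (exponential-decay 0≤y 2y≤1 i) ⟩
    1#  ∎

  power-≤1/n : ∀ {p} → 0# < p → p < 1# → ∀ k → fromℕ 2 * p ^ k ≤ 1# →
               ∀ i n .{{_ : NonZero n}} → n ℕ.≤ 2 ℕ.^ i → p ^ (k ℕ.* i) ≤ 1/ n
  power-≤1/n {p} 0<p p<1 k 2pᵏ≤1 i n n≤2ⁱ = *-cancelˡ-≤ (0<fromℕ n) (begin
    fromℕ n * p ^ (k ℕ.* i)          ≈⟨ *-congˡ (^-assocʳ p k i) ⟨
    fromℕ n * (p ^ k) ^ i            ≲⟨ *-monoˡ-≤ (^-nonneg 0≤pᵏ i) (fromℕ-mono n≤2ⁱ) ⟩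
    fromℕ (2 ℕ.^ i) * (p ^ k) ^ i    ≲⟨ exponential-decay 0≤pᵏ 2pᵏ≤1 i ⟩
    1#                               ≈⟨ n*1/n≈1 n ⟨
    fromℕ n * 1/ n                   ∎)
    where
    0≤pᵏ : 0# ≤ p ^ k
    0≤pᵏ = ^-nonneg (<⇒≤ 0<p) k

  module _ (n : ℕ) .{{_ : NonZero n}} where

    log₂-≥ : ∀ m → 2 ℕ.^ m ℕ.≤ n → fromℕ m ≤ log₂ n
    log₂-≥ m 2ᵐ≤n = begin
      fromℕ m            ≲⟨ proj₁ (proj₂ (log₂-exists n) m 1)
                              (ℕ.≤-trans 2ᵐ≤n (ℕ.≤-reflexive (≡.sym (ℕ.^-identityʳ n)))) ⟩
      fromℕ 1 * log₂ n   ≈⟨ trans (*-congʳ (+-identityʳ 1#)) (*-identityˡ _) ⟩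
      log₂ n             ∎

    log₂-≤n : log₂ n ≤ fromℕ n
    log₂-≤n = begin
      log₂ n             ≈⟨ trans (*-congʳ (+-identityʳ 1#)) (*-identityˡ _) ⟨
      fromℕ 1 * log₂ n   ≲⟨ proj₂ (proj₂ (log₂-exists n) n 1)
                              (ℕ.≤-trans (ℕ.≤-reflexive (ℕ.^-identityʳ n)) (ℕ.<⇒≤ (n<2^n n))) ⟩
      fromℕ n            ∎

    log₂/n-≤1 : log₂ n * 1/ n ≤ 1#
    log₂/n-≤1 = ≤-trans (*-monoˡ-≤ (<⇒≤ (0<1/n n)) log₂-≤n) (≤-reflexive (n*1/n≈1 n))

    1/2n : Carrier
    1/2n = (1/ (2 ℕ.* n)) {{ℕ.m*n≢0 2 n}}

    -- A union bound: 2 m failures of probability 1 / (2 n) each.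
    union-bound : ∀ m → 2 ℕ.^ m ℕ.≤ n → fromℕ (2 ℕ.* m) * 1/2n ≤ log₂ n * 1/ n
    union-bound m 2ᵐ≤n = *-cancelˡ-≤ (0<fromℕ (2 ℕ.* n) {{ℕ.m*n≢0 2 n}}) (begin
      N * (fromℕ (2 ℕ.* m) * 1/2n)      ≈⟨ solve 3 (λ N M x → N :* (M :* x) := M :* (N :* x)) refl
                                             N (fromℕ (2 ℕ.* m)) 1/2n ⟩
      fromℕ (2 ℕ.* m) * (N * 1/2n)      ≈⟨ *-congˡ (n*1/n≈1 (2 ℕ.* n) {{ℕ.m*n≢0 2 n}}) ⟩
      fromℕ (2 ℕ.* m) * 1#              ≈⟨ *-identityʳ _ ⟩
      fromℕ (2 ℕ.* m)                   ≈⟨ ×1-homo-* 2 m ⟩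
      fromℕ 2 * fromℕ m                 ≲⟨ *-monoʳ-≤ (0≤fromℕ 2) (log₂-≥ m 2ᵐ≤n) ⟩
      fromℕ 2 * log₂ n                  ≈⟨ *-identityʳ _ ⟨
      (fromℕ 2 * log₂ n) * 1#           ≈⟨ *-congˡ (n*1/n≈1 n) ⟨
      (fromℕ 2 * log₂ n) * (fromℕ n * 1/ n)
        ≈⟨ solve 4 (λ t l n x → (t :* l) :* (n :* x) := (t :* n) :* (l :* x)) refl
             (fromℕ 2) (log₂ n) (fromℕ n) (1/ n) ⟩
      (fromℕ 2 * fromℕ n) * (log₂ n * 1/ n)
                                        ≈⟨ *-congʳ (×1-homo-* 2 n) ⟨
      N * (log₂ n * 1/ n)               ∎)
      where N = fromℕ (2 ℕ.* n)

  -- Since (1 - x) ² ≤ 1 - x ≤ 1 - y.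
  square-≤ : ∀ {x y s} → 0# ≤ x → x ≤ 1# → y ≤ x → 1# ≤ s + y → (1# - x) ² ≤ s
  square-≤ {x} {y} {s} 0≤x x≤1 y≤x 1≤s+y = +-cancelʳ-≤ y (begin
    a * a + y             ≲⟨ +-monoʳ-≤ _ y≤x ⟩
    a * a + x             ≲⟨ x≤x+y (*-nonneg 0≤x 0≤a) ⟩
    a * a + x + x * a     ≈⟨ solve 2 (λ a x → a :* a :+ x :+ x :* a := (a :+ x) :* a :+ x) refl a x ⟩
    (a + x) * a + x       ≈⟨ +-congʳ (trans (*-congʳ (x-y+y≈x 1# x)) (*-identityˡ a)) ⟩
    a + x                 ≈⟨ x-y+y≈x 1# x ⟩
    1#                    ≲⟨ 1≤s+y ⟩
    s + y                 ∎)
    where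
    a = 1# - x
    0≤a : 0# ≤ a
    0≤a = +-cancelʳ-≤ x (begin
      0# + x  ≈⟨ +-identityˡ x ⟩
      x       ≲⟨ x≤1 ⟩
      1#      ≈⟨ x-y+y≈x 1# x ⟨
      a + x   ∎)

  queries-≤ : ∀ n .{{_ : NonZero n}} k m q → 2 ℕ.^ m ℕ.≤ n →
    q ℕ.≤ 2 ℕ.* m ℕ.* suc (k ℕ.* (2 ℕ.+ m)) →
    fromℕ q ≤ fromℕ (6 ℕ.* k ℕ.+ 2) * log₂ n ²
  queries-≤ n k m q 2ᵐ≤n q≤ = begin
    fromℕ q                          ≲⟨ fromℕ-mono (ℕ.≤-trans q≤ (square-bound m)) ⟩
    fromℕ (K ℕ.* (m ℕ.* m))          ≈⟨ ×1-homo-* K (m ℕ.* m) ⟩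
    fromℕ K * fromℕ (m ℕ.* m)        ≈⟨ *-congˡ (×1-homo-* m m) ⟩
    fromℕ K * (fromℕ m * fromℕ m)
      ≲⟨ *-monoʳ-≤ (0≤fromℕ K) (≤-trans (*-monoˡ-≤ (0≤fromℕ m) m≤log)
                                        (*-monoʳ-≤ (≤-trans (0≤fromℕ m) m≤log) m≤log)) ⟩
    fromℕ K * log₂ n ²               ∎
    where
    K = 6 ℕ.* k ℕ.+ 2
    m≤log : fromℕ m ≤ log₂ n
    m≤log = log₂-≥ n m 2ᵐ≤n
    expand : ∀ k m → 2 ℕ.* suc m ℕ.* suc (k ℕ.* (2 ℕ.+ suc m)) ℕ.+ 2 ℕ.* suc m ℕ.* (m ℕ.* (2 ℕ.* k ℕ.+ 1))
                     ≡ (6 ℕ.* k ℕ.+ 2) ℕ.* (suc m ℕ.* suc m)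
    expand = solve-∀
    -- For m ≥ 1, 1 + k (2 + m) ≤ m + 3 k m.
    square-bound : ∀ m → 2 ℕ.* m ℕ.* suc (k ℕ.* (2 ℕ.+ m)) ℕ.≤ K ℕ.* (m ℕ.* m)
    square-bound zero    = z≤n
    square-bound (suc m) = ℕ.≤-trans (ℕ.m≤m+n _ _) (ℕ.≤-reflexive (expand k m))

-- The algorithm

first-vertex : ∀ n .{{_ : NonZero n}} → Fin n
first-vertex (suc n) = zero

theorem5 : ∀ {c ℓ₁ ℓ₂} (R : RealNumbers c ℓ₁ ℓ₂) →
    let open RealNumbers R
        open RealProperties R
    in
    (p₁ : Carrier) → 0# < p₁ → p₁ < 1# →
    Σ[ A ∈ Algorithm R ] Σ[ C ∈ Carrier ]
      (∀ n .{{_ : NonZero n}} (G : WeightedGraph R n) (tree : WeightedGraph.IsTree G) →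
        fromℕ (queries (A n G tree)) ≤ C * (log₂ n) ² ×
        (∀ (t : Target → Fin n) (responder : Responder R G t) →
          (1# - (log₂ n * 1/ n)) ² ≤
            Pr R (detectsBoth? t) (run R p₁ responder (A n G tree))))
theorem5 R p₁ 0<p₁ p₁<1 = algorithm , fromℕ (6 ℕ.* k ℕ.+ 2) , λ n G tree →
  queries-≤ n k (m n) _ (proj₁ (proj₂ (floor-log₂ n)))
    (queries-compile (k ℕ.* (2 ℕ.+ m n)) (search n G tree)) ,
  λ t responder →
    square-≤ (log/n-nonneg n) (log₂/n-≤1 n)
      (union-bound n (m n) (proj₁ (proj₂ (floor-log₂ n))))
      (compile-success p₁ 0<p₁ p₁<1 tree t responder (k ℕ.* (2 ℕ.+ m n)) (1/2n n)
        (<⇒≤ (0<1/n (2 ℕ.* n) {{ℕ.m*n≢0 2 n}})) (miss n)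
        (search n G tree) (solves n G tree t) [])
  where
  open RealNumbers R hiding (zero)
  open RealProperties R
  open Order R
  open Estimates R
  open Probability R
  open import Algebra.Properties.Semiring.Exp semiring using (_^_)

  p₂ : Carrier
  p₂ = 1# - p₁
  0<p₂ : 0# < p₂
  0<p₂ = x<y⇒0<y-x p₁<1
  p₂<1 : p₂ < 1#
  p₂<1 = +-cancelʳ-< p₁ (<-respˡ-≈ (sym (x-y+y≈x 1# p₁))
    (<-respˡ-≈ (+-identityʳ 1#) (+-monoʳ-< 1# 0<p₁)))

  -- The exponent k serves for p₁ as well as for p₂.
  k₁ k₂ k : ℕ
  k₁ = proj₁ (halving 0<p₁ p₁<1)
  k₂ = proj₁ (halving 0<p₂ p₂<1)
  k = k₁ ℕ.+ k₂

  m : ∀ n .{{_ : NonZero n}} → ℕ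
  m n = proj₁ (floor-log₂ n)

  search : ∀ n .{{_ : NonZero n}} (G : WeightedGraph R n) →
           WeightedGraph.IsTree G → Search n (2 ℕ.* m n)
  search n G tree = Trees.locateBoth R G tree (first-vertex n) (m n) (allFin n)

  algorithm : Algorithm R
  algorithm n G tree = compile (k ℕ.* (2 ℕ.+ m n)) (search n G tree)

  solves : ∀ n .{{_ : NonZero n}} (G : WeightedGraph R n) (tree : WeightedGraph.IsTree G)
           (t : Target → Fin n) → Trees.Solves R G tree t (search n G tree)
  solves n G tree t = Trees.locateBoth-solves R G tree (first-vertex n) t (m n)
    (λ τ → ∈-allFin (t τ))
    (≡.subst (ℕ._< 2 ℕ.^ suc (m n)) (≡.sym (length-tabulate id)) (proj₂ (proj₂ (floor-log₂ n))))

  -- The exponent 2 + m n suffices because 2 n ≤ 2 ^ (2 + m n).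
  miss : ∀ n .{{_ : NonZero n}} τ → prob p₁ 0<p₁ p₁<1 τ ^ (k ℕ.* (2 ℕ.+ m n)) ≤ 1/2n n
  miss n first = power-≤1/n 0<p₁ p₁<1 k (halving-+ 0<p₁ p₁<1 k₁ k₂ (proj₂ (halving 0<p₁ p₁<1)))
    (2 ℕ.+ m n) (2 ℕ.* n) {{ℕ.m*n≢0 2 n}}
    (ℕ.*-monoʳ-≤ 2 (ℕ.<⇒≤ (proj₂ (proj₂ (floor-log₂ n)))))
  miss n second = power-≤1/n 0<p₂ p₂<1 k
    (≡.subst (λ i → fromℕ 2 * p₂ ^ i ≤ 1#) (ℕ.+-comm k₂ k₁)
      (halving-+ 0<p₂ p₂<1 k₂ k₁ (proj₂ (halving 0<p₂ p₂<1))))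
    (2 ℕ.+ m n) (2 ℕ.* n) {{ℕ.m*n≢0 2 n}}
    (ℕ.*-monoʳ-≤ 2 (ℕ.<⇒≤ (proj₂ (proj₂ (floor-log₂ n)))))

  log/n-nonneg : ∀ n .{{_ : NonZero n}} → 0# ≤ log₂ n * 1/ n
  log/n-nonneg n = *-nonneg
    (≤-trans (0≤fromℕ (m n)) (log₂-≥ n (m n) (proj₁ (proj₂ (floor-log₂ n)))))
    (<⇒≤ (0<1/n n))
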